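{- Let $n\geq 3$ and let $\ell$ be an integer with $9n/10 \leq \ell \leq n$. If $G$ and $G'$ are graphs on $n$ vertices with $\mathcal{D}_\ell(G)=\mathcal{D}_\ell(G')$, then $G$ is connected if and only if $G'$ is connected.
   Context: All graphs are finite, simple and undirected. For a graph $G$ and an integer $\ell$, the $\ell$-deck $\mathcal{D}_\ell(G)$ is the multiset of isomorphism classes of all induced subgraphs of $G$ on exactly $\ell$ vertices (one for each $\ell$-subset of $V(G)$). -}

module Defs where

open import Data.Nat using (ℕ)
open import Data.Bool using (Bool; true; false)
open import Data.Fin using (Fin)
open import Data.Fin.Subset using (Subset; _∈_; ∣_∣)
open import Data.Product using (Σ; _×_; _,_; proj₁)
open import Relation.Binary.PropositionalEquality using (_≡_)
open import Function.Bundles using (_⤖_; Bijection)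

record Graph (n : ℕ) : Set where
  field
    adj   : Fin n → Fin n → Bool
    sym   : ∀ u v → adj u v ≡ adj v u
    irrefl : ∀ v → adj v v ≡ false
open Graph public

Elem : {n : ℕ} → Subset n → Set
Elem {n} S = Σ (Fin n) (λ v → v ∈ S)

InducedIso : {n : ℕ} → Graph n → Subset n → Graph n → Subset n → Set
InducedIso G S G' T =
  Σ (Elem S ⤖ Elem T) λ f →
    ∀ (x y : Elem S) →
      adj G (proj₁ x) (proj₁ y) ≡ adj G' (proj₁ (Bijection.to f x)) (proj₁ (Bijection.to f y))

Subsetℓ : ℕ → ℕ → Set
Subsetℓ n ℓ = Σ (Subset n) (λ S → ∣ S ∣ ≡ ℓ)

-- Equality of ℓ-decks as multisets of isomorphism classes: there is a
-- bijection σ between the ℓ-subsets of V(G) and those of V(G') such that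
-- G[S] ≅ G'[σ S] for every ℓ-subset S.
SameDeck : {n : ℕ} → ℕ → Graph n → Graph n → Set
SameDeck {n} ℓ G G' =
  Σ (Subsetℓ n ℓ ⤖ Subsetℓ n ℓ) λ σ →
    ∀ (S : Subsetℓ n ℓ) → InducedIso G (proj₁ S) G' (proj₁ (Bijection.to σ S))

data Reachable {n : ℕ} (G : Graph n) : Fin n → Fin n → Set where
  here : ∀ {v} → Reachable G v v
  step : ∀ {u w v} → adj G u w ≡ true → Reachable G w v → Reachable G u v

Connected : {n : ℕ} → Graph n → Set
Connected {n} G = ∀ (u v : Fin n) → Reachable G u v

module Submission where

-- Write r = n − ℓ, so 10 r ≤ n. Suppose G is connected and G′ is not. Some ℓ-vertex card is connected, so G′ has
-- a connected set of ℓ vertices, and a component of G′ missing that set has h vertices with 1 ≤ h ≤ r. Put N = n − h.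
--
-- For a connected set A of h vertices let d(A) be the number of outside vertices adjacent to A, and c(A) = N − d(A).
-- By Kelly's lemma the deck determines Σ_A C(c(A), j) for j ≤ ℓ − h, hence Σ_A p(d(A)) for every polynomial p of
-- degree at most ℓ − h = N − r. Take p(d) = C(N − d, M) C(d − 1, 3r) with M = N − 4r. In G no A has d(A) = 0,
-- in G′ some A does, and |p(0)| = C(N, M); so in G or in G′ the sum of p(d(A)) over d(A) ≥ 1 is at least C(N, M).
--
-- On the other hand exploring from a vertex, as in site percolation with density 1/5, gives
-- Σ_{A ∋ v} 4^d(A) 5^c(A) ≤ 5^(n−1), so that h Σ_A 4^d(A) 5^c(A) ≤ n 5^(n−1). Since
-- 2 n 5^(n−1) p(d) ≤ h C(N, M) 4^d 5^(N−d) for all d ≥ 1, that sum is at most C(N, M) / 2.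

open import Defs renaming (sym to adj-sym)
open import Data.Bool using (true; false; if_then_else_)
import Data.Bool as Bool
open import Data.Bool.Properties using (¬-not)
open import Data.Empty using (⊥; ⊥-elim)
open import Data.Fin using (Fin; zero; suc)
import Data.Fin as Fin
open import Data.Fin.Properties using (any?; all?)
open import Data.Fin.Subset
  using (Subset; _∈_; _∉_; _⊆_; ∣_∣; inside; outside; _∪_; _∩_; ∁; ⁅_⁆; Nonempty; Empty)
  renaming (⊥ to ∅)
open import Data.Fin.Subset.Properties
open import Data.List using (List; []; _∷_; map; _++_; allFin; length)
open import Data.List.Membership.Propositional using () renaming (_∈_ to _∈ₗ_)
open import Data.List.Membership.Propositional.Properties
  using (∈-map⁺; ∈-map⁻; ∈-++⁺ˡ; ∈-++⁺ʳ; ∈-allFin)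
open import Data.List.Properties using (map-tabulate; length-tabulate)
open import Data.List.Relation.Unary.All using (All; []; _∷_)
open import Data.List.Relation.Unary.AllPairs using ([]; _∷_)
open import Data.List.Relation.Unary.Any using () renaming (here to hereₗ; there to thereₗ)
open import Data.List.Relation.Unary.Unique.Propositional using (Unique)
open import Data.List.Relation.Unary.Unique.Propositional.Properties as Unique using (allFin⁺)
open import Data.Nat
open import Data.Nat.Combinatorics
  using (_C_; nCk+nC[k+1]≡[n+1]C[k+1]; nCk≡n!/k![n-k]!; k![n∸k]!∣n!; nC1≡n; k>n⇒nCk≡0)
open import Data.Nat.DivMod using (m/n*n≡m)
open import Data.Nat.Properties
open import Data.Nat.Tactic.RingSolver using (solve-∀)
open import Data.Product using (_,_; ∃; _×_; proj₁; proj₂)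
open import Data.Sum using (_⊎_; inj₁; inj₂; [_,_]′)
open import Data.Unit using (tt)
open import Data.Vec using ([]; _∷_; tabulate)
open import Data.Vec.Base using (here; there)
open import Data.Vec.Properties using (≡-dec; ∷-injectiveʳ; []=⇒lookup; lookup⇒[]=; lookup∘tabulate)
open import Data.Vec.Properties.WithK using ([]=-irrelevant)
open import Function using (_∘_)
open import Function.Bundles using (_⤖_; Bijection; _⇔_; mk⇔)
open import Function.Construct.Symmetry using (⤖-sym)
open import Relation.Binary using (DecidableEquality)
open import Relation.Binary.PropositionalEquality
open import Relation.Nullary
open import Relation.Nullary.Decidable using (_×-dec_; ¬?; _→-dec_; dec-true)

-- Binomial coefficients

-- Connected sets of h vertices may be exponentially many, and only moments of degree at most ℓ - h
-- are known, so p must be negligible against the percolation weight at every d ≥ 1. Now C(N - d, M)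
-- vanishes for d > 4r and C(d - 1, 3r) for 1 ≤ d ≤ 3r, which leaves the window 3r < d ≤ 4r; with M
-- = N - 4r the degree M + 3r = ℓ - h is used up exactly. In the window p(d) / C(N, M) = C(d - 1,
-- 3r) C(4r, d) / C(N, d). Percolation with density q costs a factor q^(-h) (1 - q)^(-d); for h = r
-- and d = 4r it is least at q = 1/5. From 10 r ≤ n follows N ≥ 9r, so C(N, d) ≥ C(9r, 3r + 1). The
-- latter grows per unit of r by a factor tending to 3^9 / 2^6, about 307, against 5 * 8^4 * 10^4 /
-- 7^7, about 249, for the remaining factors. Everything stays in the natural numbers: quotients are
-- cleared, `C-absorb` is (k + 1) C(n, k + 1) = (n - k) C(n, k) without subtraction, and signs
-- become a case distinction on which graph has the surplus.

C-absorb : ∀ n k → suc k * (n C suc k) + k * (n C k) ≡ n * (n C k)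
C-absorb zero    zero    = refl
C-absorb zero    (suc k) = cong₂ _+_ (*-zeroʳ k) (*-zeroʳ k)
C-absorb (suc n) zero    = trans (ring (suc n C 1)) (trans (nC1≡n (suc n)) (sym (*-identityʳ (suc n))))
  where
  ring : ∀ x → 1 * x + 0 * 1 ≡ x
  ring = solve-∀
C-absorb (suc n) (suc k)
  rewrite sym (nCk+nC[k+1]≡[n+1]C[k+1] n k) | sym (nCk+nC[k+1]≡[n+1]C[k+1] n (suc k)) = begin
    suc (suc k) * (b + c) + suc k * (a + b)
      ≡⟨ split k a b c ⟩
    (suc (suc k) * c + suc k * b) + (suc k * b + k * a) + (a + b)
      ≡⟨ cong₂ (λ x y → x + y + (a + b)) (C-absorb n (suc k)) (C-absorb n k) ⟩
    n * b + n * a + (a + b)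
      ≡⟨ merge n a b ⟩
    suc n * (a + b) ∎
  where
  open ≡-Reasoning
  a = n C k
  b = n C suc k
  c = n C suc (suc k)
  split : ∀ k a b c → suc (suc k) * (b + c) + suc k * (a + b)
        ≡ (suc (suc k) * c + suc k * b) + (suc k * b + k * a) + (a + b)
  split = solve-∀
  merge : ∀ n a b → n * b + n * a + (a + b) ≡ suc n * (a + b)
  merge = solve-∀

C-extract : ∀ n k → suc k * (suc n C suc k) ≡ suc n * (n C k)
C-extract n k = begin
  suc k * (suc n C suc k)              ≡⟨ cong (suc k *_) (nCk+nC[k+1]≡[n+1]C[k+1] n k) ⟨
  suc k * (n C k + n C suc k)          ≡⟨ split k (n C k) (n C suc k) ⟩
  n C k + (suc k * (n C suc k) + k * (n C k)) ≡⟨ cong (n C k +_) (C-absorb n k) ⟩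
  suc n * (n C k)                      ∎
  where
  open ≡-Reasoning
  split : ∀ k a b → suc k * (a + b) ≡ a + (suc k * b + k * a)
  split = solve-∀

[a+b]Ca*a!b! : ∀ a b → ((a + b) C a) * (a ! * b !) ≡ (a + b) !
[a+b]Ca*a!b! a b = begin
  ((a + b) C a) * (a ! * b !)
    ≡⟨ cong (λ x → ((a + b) C a) * (a ! * x !)) (m+n∸m≡n a b) ⟨
  ((a + b) C a) * (a ! * (a + b ∸ a) !)
    ≡⟨ cong (_* (a ! * (a + b ∸ a) !)) (nCk≡n!/k![n-k]! (m≤m+n a b)) ⟩
  _
    ≡⟨ m/n*n≡m (k![n∸k]!∣n! (m≤m+n a b)) ⟩
  (a + b) ! ∎
  where
  open ≡-Reasoning
  instance _ = a !* (a + b ∸ a) !≢0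

nCk>0 : ∀ {n k} → k ≤ n → 0 < n C k
nCk>0 {n} {k} k≤n = n≢0⇒n>0 λ nCk≡0 → n!≢0 (trans (sym identity) (cong (_* (k ! * (n ∸ k) !)) nCk≡0))
  where
  n!≢0 : n ! ≢ 0
  n!≢0 = ≢-nonZero⁻¹ (n !) {{n !≢0}}
  identity : (n C k) * (k ! * (n ∸ k) !) ≡ n !
  identity = subst (λ z → (z C k) * (k ! * (n ∸ k) !) ≡ z !) (m+[n∸m]≡n k≤n) ([a+b]Ca*a!b! k (n ∸ k))

C-mono : ∀ {m n} k → m ≤ n → m C k ≤ n C k
C-mono {m} k m≤n = go (≤⇒≤′ m≤n)
  where
  C-suc : ∀ n k → n C k ≤ suc n C k
  C-suc n zero    = ≤-refl
  C-suc n (suc k) = subst (n C suc k ≤_) (nCk+nC[k+1]≡[n+1]C[k+1] n k) (m≤n+m _ _)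
  go : ∀ {n} → m ≤′ n → m C k ≤ n C k
  go ≤′-refl        = ≤-refl
  go (≤′-step {n} p) = ≤-trans (go p) (C-suc n k)

-- The left side is one term of the binomial expansion of (1 + x)^n.
C-power-bound : ∀ x n k → (n C k) * x ^ k ≤ suc x ^ n
C-power-bound x n       zero    = subst (_≤ suc x ^ n) (sym (*-identityʳ 1)) (m^n>0 (suc x) n)
C-power-bound x zero    (suc k) = z≤n
C-power-bound x (suc n) (suc k) = begin
  (suc n C suc k) * x ^ suc k
    ≡⟨ cong (_* x ^ suc k) (nCk+nC[k+1]≡[n+1]C[k+1] n k) ⟨
  (n C k + n C suc k) * x ^ suc k
    ≡⟨ split x (n C k) (n C suc k) (x ^ k) ⟩
  (n C suc k) * x ^ suc k + x * ((n C k) * x ^ k)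
    ≤⟨ +-mono-≤ (C-power-bound x n (suc k)) (*-monoʳ-≤ x (C-power-bound x n k)) ⟩
  suc x ^ suc n ∎
  where
  open ≤-Reasoning
  split : ∀ x a b p → (a + b) * (x * p) ≡ b * (x * p) + x * (a * p)
  split = solve-∀

-- Both sides are the multinomial coefficient (M + t + d)! / (M! t! d!) when c = M + t, and vanish when c < M.
trinomial-revision : ∀ {N M s c d} → c + d ≡ N → M + s ≡ N → (c C M) * (N C d) ≡ (N C M) * (s C d)
trinomial-revision {N} {M} {s} {c} {d} c+d≡N M+s≡N with M ≤? c
... | no M≰c = trans (cong (_* (N C d)) (k>n⇒nCk≡0 (≰⇒> M≰c)))
                    (sym (trans (cong ((N C M) *_) (k>n⇒nCk≡0 s<d)) (*-zeroʳ (N C M))))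
  where
  s<d : s < d
  s<d = +-cancelˡ-< M s d (subst (_< M + d) (trans c+d≡N (sym M+s≡N)) (+-monoˡ-< d (≰⇒> M≰c)))
... | yes M≤c with t , c≡ ← m≤n⇒∃[o]m+o≡n M≤c = *-cancelʳ-≡ _ _ (M ! * t ! * d !) {{nz}} (trans left (sym right))
  where
  open ≡-Reasoning
  nz : NonZero (M ! * t ! * d !)
  nz = m*n≢0 (M ! * t !) (d !) {{m*n≢0 (M !) (t !) {{M !≢0}} {{t !≢0}}}} {{d !≢0}}
  s≡ : s ≡ d + t
  s≡ = +-cancelˡ-≡ M s (d + t) (begin
    M + s       ≡⟨ trans M+s≡N (sym c+d≡N) ⟩
    c + d       ≡⟨ cong (_+ d) c≡ ⟨
    M + t + d   ≡⟨ +-assoc M t d ⟩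
    M + (t + d) ≡⟨ cong (M +_) (+-comm t d) ⟩
    M + (d + t) ∎)
  d+c≡N : d + c ≡ N
  d+c≡N = trans (+-comm d c) c+d≡N
  CM : (c C M) * (M ! * t !) ≡ c !
  CM = subst (λ z → (z C M) * (M ! * t !) ≡ z !) c≡ ([a+b]Ca*a!b! M t)
  Nd : (N C d) * (d ! * c !) ≡ N !
  Nd = subst (λ z → (z C d) * (d ! * c !) ≡ z !) d+c≡N ([a+b]Ca*a!b! d c)
  NM : (N C M) * (M ! * s !) ≡ N !
  NM = subst (λ z → (z C M) * (M ! * s !) ≡ z !) M+s≡N ([a+b]Ca*a!b! M s)
  sd : (s C d) * (d ! * t !) ≡ s !
  sd = subst (λ z → (z C d) * (d ! * t !) ≡ z !) (sym s≡) ([a+b]Ca*a!b! d t)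
  regroup₁ : ∀ x y a b e → x * y * (a * b * e) ≡ y * (e * (x * (a * b)))
  regroup₁ = solve-∀
  regroup₂ : ∀ x y a b e → x * y * (a * b * e) ≡ x * (a * (y * (e * b)))
  regroup₂ = solve-∀
  left : (c C M) * (N C d) * (M ! * t ! * d !) ≡ N !
  left = begin
    (c C M) * (N C d) * (M ! * t ! * d !)     ≡⟨ regroup₁ (c C M) (N C d) (M !) (t !) (d !) ⟩
    (N C d) * (d ! * ((c C M) * (M ! * t !))) ≡⟨ cong (λ z → (N C d) * (d ! * z)) CM ⟩
    (N C d) * (d ! * c !)                     ≡⟨ Nd ⟩
    N !                                       ∎
  right : (N C M) * (s C d) * (M ! * t ! * d !) ≡ N !
  right = begin
    (N C M) * (s C d) * (M ! * t ! * d !)     ≡⟨ regroup₂ (N C M) (s C d) (M !) (t !) (d !) ⟩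
    (N C M) * (M ! * ((s C d) * (d ! * t !))) ≡⟨ cong (λ z → (N C M) * (M ! * z)) sd ⟩
    (N C M) * (M ! * s !)                     ≡⟨ NM ⟩
    N !                                       ∎

-- In (k + 1) C(n, k + 1) = (n - k) C(n, k) the hypothesis gives n - k ≥ k + 1; adding `k * (n C k)`
-- to both sides removes the subtraction.
C-ascend : ∀ n k → k + suc k ≤ n → n C k ≤ n C suc k
C-ascend n k 2k<n = *-cancelˡ-≤ (suc k) (+-cancelʳ-≤ (k * (n C k)) _ _ (begin
  suc k * (n C k) + k * (n C k)     ≡⟨ merge k (n C k) ⟩
  (k + suc k) * (n C k)             ≤⟨ *-monoˡ-≤ (n C k) 2k<n ⟩
  n * (n C k)                       ≡⟨ C-absorb n k ⟨
  suc k * (n C suc k) + k * (n C k) ∎))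
  where
  open ≤-Reasoning
  merge : ∀ k a → suc k * a + k * a ≡ (k + suc k) * a
  merge = solve-∀

C-ascending : ∀ {n k l} → k ≤ l → l + l ≤ suc n → n C k ≤ n C l
C-ascending {n} k≤l = go (≤⇒≤′ k≤l)
  where
  go : ∀ {k l} → k ≤′ l → l + l ≤ suc n → n C k ≤ n C l
  go ≤′-refl 2l≤ = ≤-refl
  go (≤′-step {l} k≤l) 2l≤ = ≤-trans (go k≤l (≤-trans (+-mono-≤ (n≤1+n l) (n≤1+n l)) 2l≤))
                                     (C-ascend n l (s≤s⁻¹ 2l≤))

-- The quotient C(x, k + 1) / x = C(x - 1, k) / (k + 1) does not decrease with x. Used with m = 9r
-- and n = N, it yields the factor N that absorbs the n of the percolation bound.
C-scaling : ∀ {m n} k → m ≤ n → n * (m C suc k) ≤ m * (n C suc k)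
C-scaling {zero}  {n}     k m≤n = ≤-reflexive (*-zeroʳ n)
C-scaling {suc m} {suc n} k m≤n = *-cancelˡ-≤ (suc k) (begin
  suc k * (suc n * (suc m C suc k)) ≡⟨ swap (suc k) (suc n) (suc m C suc k) ⟩
  suc n * (suc k * (suc m C suc k)) ≡⟨ cong (suc n *_) (C-extract m k) ⟩
  suc n * (suc m * (m C k))         ≤⟨ *-monoʳ-≤ (suc n) (*-monoʳ-≤ (suc m) (C-mono k (s≤s⁻¹ m≤n))) ⟩
  suc n * (suc m * (n C k))         ≡⟨ swap (suc n) (suc m) (n C k) ⟩
  suc m * (suc n * (n C k))         ≡⟨ cong (suc m *_) (C-extract n k) ⟨
  suc m * (suc k * (suc n C suc k)) ≡⟨ swap (suc m) (suc k) (suc n C suc k) ⟩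
  suc k * (suc m * (suc n C suc k)) ∎)
  where
  open ≤-Reasoning
  swap : ∀ a b c → a * (b * c) ≡ b * (a * c)
  swap = solve-∀

-- Growth of the binomials C(9r, 3r + 1)

pairing₁ : ∀ s → 85 * ((7 + 3 * s) * (6 + 6 * s)) ≤ 21 * ((10 + 9 * s) * (17 + 9 * s))
pairing₁ s = subst (85 * ((7 + 3 * s) * (6 + 6 * s)) ≤_) (ring s) (m≤m+n _ _)
  where
  ring : ∀ s → 85 * ((7 + 3 * s) * (6 + 6 * s)) + s * (3 + 171 * s) ≡ 21 * ((10 + 9 * s) * (17 + 9 * s))
  ring = solve-∀

-- As for `pairing₁`, the difference of the sides is a polynomial in s with nonnegative
-- coefficients. The constants come from s = 0: there 21/85 is the exact quotient, and 5/23 is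
-- slightly above the quotient 6930/32032.
pairing₂ : ∀ s → 23 * (((7 + 6 * s) * (11 + 6 * s)) * ((9 + 6 * s) * (10 + 6 * s)))
               ≤ 5 * (((11 + 9 * s) * (16 + 9 * s)) * ((13 + 9 * s) * (14 + 9 * s)))
pairing₂ s = subst (23 * (((7 + 6 * s) * (11 + 6 * s)) * ((9 + 6 * s) * (10 + 6 * s))) ≤_) (ring s) (m≤m+n _ _)
  where
  ring : ∀ s → 23 * (((7 + 6 * s) * (11 + 6 * s)) * ((9 + 6 * s) * (10 + 6 * s)))
             + ((((s * 2997 + 13014) * s + 18783) * s + 9516) * s + 770)
       ≡ 5 * (((11 + 9 * s) * (16 + 9 * s)) * ((13 + 9 * s) * (14 + 9 * s)))
  ring = solve-∀

rise₃ rise₆ rise₉ : ℕ → ℕ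
rise₃ k = (3 + k) * (2 + k) * (1 + k)
rise₆ k = (6 + k) * (5 + k) * (4 + k) * (3 + k) * (2 + k) * (1 + k)
rise₉ k = (9 + k) * (8 + k) * (7 + k) * (6 + k) * (5 + k) * (4 + k) * (3 + k) * (2 + k) * (1 + k)

rise₃-! : ∀ k → rise₃ k * k ! ≡ (3 + k) !
rise₃-! k = reassoc (3 + k) (2 + k) (1 + k) (k !)
  where
  reassoc : ∀ a b c x → (a * b * c) * x ≡ a * (b * (c * x))
  reassoc = solve-∀

rise₆-! : ∀ k → rise₆ k * k ! ≡ (6 + k) !
rise₆-! k = reassoc (6 + k) (5 + k) (4 + k) (3 + k) (2 + k) (1 + k) (k !)
  where
  reassoc : ∀ a b c d e f x → (a * b * c * d * e * f) * x ≡ a * (b * (c * (d * (e * (f * x)))))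
  reassoc = solve-∀

rise₉-! : ∀ k → rise₉ k * k ! ≡ (9 + k) !
rise₉-! k = reassoc (9 + k) (8 + k) (7 + k) (6 + k) (5 + k) (4 + k) (3 + k) (2 + k) (1 + k) (k !)
  where
  reassoc : ∀ a b c d e f g h i x → (a * b * c * d * e * f * g * h * i) * x
          ≡ a * (b * (c * (d * (e * (f * (g * (h * (i * x))))))))
  reassoc = solve-∀

-- The factorial formula, compared before and after p grows by 3 and q by 6. Raising r by one does
-- exactly this to C(9r, 3r + 1), where p = 3r + 1 and q = 6r - 1.
C-ratio : ∀ p q → (((3 + p) + (6 + q)) C (3 + p)) * (rise₃ p * rise₆ q) ≡ ((p + q) C p) * rise₉ (p + q)
C-ratio p q = *-cancelʳ-≡ _ _ (p ! * q !) {{p !* q !≢0}} (begin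
  B′ * (rise₃ p * rise₆ q) * (p ! * q !)      ≡⟨ regroup B′ (rise₃ p) (rise₆ q) (p !) (q !) ⟩
  B′ * ((rise₃ p * p !) * (rise₆ q * q !))    ≡⟨ cong₂ (λ x y → B′ * (x * y)) (rise₃-! p) (rise₆-! q) ⟩
  B′ * ((3 + p) ! * (6 + q) !)                ≡⟨ [a+b]Ca*a!b! (3 + p) (6 + q) ⟩
  ((3 + p) + (6 + q)) !                       ≡⟨ cong _! (shift p q) ⟩
  (9 + (p + q)) !                             ≡⟨ rise₉-! (p + q) ⟨
  rise₉ (p + q) * (p + q) !                   ≡⟨ cong (rise₉ (p + q) *_) ([a+b]Ca*a!b! p q) ⟨
  rise₉ (p + q) * (B * (p ! * q !))           ≡⟨ swap (rise₉ (p + q)) B (p ! * q !) ⟩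
  B * rise₉ (p + q) * (p ! * q !)             ∎)
  where
  open ≡-Reasoning
  B B′ : ℕ
  B = (p + q) C p
  B′ = ((3 + p) + (6 + q)) C (3 + p)
  regroup : ∀ z u v x y → z * (u * v) * (x * y) ≡ z * ((u * x) * (v * y))
  regroup = solve-∀
  shift : ∀ p q → (3 + p) + (6 + q) ≡ 9 + (p + q)
  shift = solve-∀
  swap : ∀ a b c → a * (b * c) ≡ b * a * c
  swap = solve-∀

-- The two products are split so that each paired quotient is bounded by a constant.
rise-bound : ∀ s → (5 * (8 ^ 4 * 10 ^ 4)) * (rise₃ (4 + 3 * s) * rise₆ (5 + 6 * s)) ≤ 7 ^ 7 * rise₉ (9 + 9 * s)
-- Both products contain `W`: 8 + 6s = 2 (4 + 3s) supplies the factor 2 on the left, and the three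
-- multiples of 3 in `rise₉` supply 27 on the right. The factor 105 = 21 * 5 clears the constants of
-- the two pairings.
rise-bound s = *-cancelˡ-≤ 105 (begin
  105 * ((5 * (8 ^ 4 * 10 ^ 4)) * (rise₃ (4 + 3 * s) * rise₆ (5 + 6 * s)))
    ≡⟨ cong (λ z → 105 * ((5 * (8 ^ 4 * 10 ^ 4)) * z)) (group₁ s) ⟩
  105 * ((5 * (8 ^ 4 * 10 ^ 4)) * (2 * (W * (a * b))))
    ≡⟨ pull 105 (5 * (8 ^ 4 * 10 ^ 4)) 2 (W * (a * b)) ⟩
  105 * (5 * (8 ^ 4 * 10 ^ 4)) * 2 * (W * (a * b))
    ≤⟨ *-monoˡ-≤ (W * (a * b)) (≤ᵇ⇒≤ (105 * (5 * (8 ^ 4 * 10 ^ 4)) * 2) (27 * 7 ^ 7 * 85 * 23) tt) ⟩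
  27 * 7 ^ 7 * 85 * 23 * (W * (a * b))
    ≡⟨ distribute 27 (7 ^ 7) 85 23 W a b ⟩
  27 * 7 ^ 7 * (W * ((85 * a) * (23 * b)))
    ≤⟨ *-monoʳ-≤ (27 * 7 ^ 7) (*-monoʳ-≤ W (*-mono-≤ (pairing₁ s) (pairing₂ s))) ⟩
  27 * 7 ^ 7 * (W * ((21 * a′) * (5 * b′)))
    ≡⟨ collect 27 (7 ^ 7) 21 5 W a′ b′ ⟩
  21 * 5 * (7 ^ 7 * (27 * (W * (a′ * b′))))
    ≡⟨ cong (λ z → 105 * (7 ^ 7 * z)) (group₂ s) ⟨
  105 * (7 ^ 7 * rise₉ (9 + 9 * s)) ∎)
  where
  open ≤-Reasoning
  W a b a′ b′ : ℕ
  W = (4 + 3 * s) * (5 + 3 * s) * (6 + 3 * s)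
  a = (7 + 3 * s) * (6 + 6 * s)
  b = ((7 + 6 * s) * (11 + 6 * s)) * ((9 + 6 * s) * (10 + 6 * s))
  a′ = (10 + 9 * s) * (17 + 9 * s)
  b′ = ((11 + 9 * s) * (16 + 9 * s)) * ((13 + 9 * s) * (14 + 9 * s))
  pull : ∀ a b c d → a * (b * (c * d)) ≡ a * b * c * d
  pull = solve-∀
  distribute : ∀ a b c d e f g → a * b * c * d * (e * (f * g)) ≡ a * b * (e * ((c * f) * (d * g)))
  distribute = solve-∀
  collect : ∀ a b c d e f g → a * b * (e * ((c * f) * (d * g))) ≡ c * d * (b * (a * (e * (f * g))))
  collect = solve-∀
  double : ∀ s → 8 + 6 * s ≡ 2 * (4 + 3 * s)
  double = solve-∀
  triple : ∀ k s → 3 * k + 9 * s ≡ 3 * (k + 3 * s)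
  triple = solve-∀
  shuffle₁ : ∀ c x y w d e f g h i → (d * y * x) * (i * h * g * (c * w) * f * e)
           ≡ c * ((w * x * y) * ((d * e) * ((f * i) * (g * h))))
  shuffle₁ = solve-∀
  shuffle₂ : ∀ x y z a b c d e f → (3 * z) * f * e * (3 * y) * d * c * (3 * x) * b * a
           ≡ 27 * ((x * y * z) * ((a * f) * ((b * e) * (c * d))))
  shuffle₂ = solve-∀
  group₁ : ∀ s → rise₃ (4 + 3 * s) * rise₆ (5 + 6 * s)
    ≡ 2 * (((4 + 3 * s) * (5 + 3 * s) * (6 + 3 * s)) * (((7 + 3 * s) * (6 + 6 * s)) * (((7 + 6 * s) * (11 + 6 * s)) * ((9 + 6 * s) * (10 + 6 * s)))))
  group₁ s = trans
    (cong (λ z → rise₃ (4 + 3 * s) * ((11 + 6 * s) * (10 + 6 * s) * (9 + 6 * s) * z * (7 + 6 * s) * (6 + 6 * s))) (double s))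
    (shuffle₁ 2 (5 + 3 * s) (6 + 3 * s) (4 + 3 * s) (7 + 3 * s) (6 + 6 * s) (7 + 6 * s) (9 + 6 * s) (10 + 6 * s) (11 + 6 * s))
  group₂ : ∀ s → rise₉ (9 + 9 * s)
    ≡ 27 * (((4 + 3 * s) * (5 + 3 * s) * (6 + 3 * s)) * (((10 + 9 * s) * (17 + 9 * s)) * (((11 + 9 * s) * (16 + 9 * s)) * ((13 + 9 * s) * (14 + 9 * s)))))
  group₂ s = trans
    (cong₂ (λ y z → z * (17 + 9 * s) * (16 + 9 * s) * y * (14 + 9 * s) * (13 + 9 * s) * (12 + 9 * s) * (11 + 9 * s) * (10 + 9 * s))
      (triple 5 s) (triple 6 s))
    (trans (cong (λ x → (3 * (6 + 3 * s)) * (17 + 9 * s) * (16 + 9 * s) * (3 * (5 + 3 * s)) * (14 + 9 * s) * (13 + 9 * s) * x * (11 + 9 * s) * (10 + 9 * s))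
        (triple 4 s))
      (shuffle₂ (4 + 3 * s) (5 + 3 * s) (6 + 3 * s) (10 + 9 * s) (11 + 9 * s) (13 + 9 * s) (14 + 9 * s) (16 + 9 * s) (17 + 9 * s)))

C-growth : ∀ {a b} s → a * (rise₃ (4 + 3 * s) * rise₆ (5 + 6 * s)) ≤ b * rise₉ (9 + 9 * s) →
  a * ((9 + 9 * s) C (4 + 3 * s)) ≤ b * ((9 + 9 * suc s) C (4 + 3 * suc s))
C-growth {a} {b} s rises≤ = *-cancelʳ-≤ _ _ (rise₃ p * rise₆ q) (begin
  a * B * (rise₃ p * rise₆ q)   ≡⟨ swap a B (rise₃ p * rise₆ q) ⟩
  B * (a * (rise₃ p * rise₆ q)) ≤⟨ *-monoʳ-≤ B rises≤ ⟩
  B * (b * rise₉ (9 + 9 * s))   ≡⟨ swap′ B b (rise₉ (9 + 9 * s)) ⟩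
  b * (B * rise₉ (9 + 9 * s))   ≡⟨ cong (b *_) ratio ⟨
  b * (B′ * (rise₃ p * rise₆ q)) ≡⟨ *-assoc b B′ (rise₃ p * rise₆ q) ⟨
  b * B′ * (rise₃ p * rise₆ q)  ∎)
  where
  open ≤-Reasoning
  p q B B′ : ℕ
  p = 4 + 3 * s
  q = 5 + 6 * s
  B = (9 + 9 * s) C (4 + 3 * s)
  B′ = (9 + 9 * suc s) C (4 + 3 * suc s)
  swap : ∀ a b c → a * b * c ≡ b * (a * c)
  swap = solve-∀
  swap′ : ∀ a b c → a * (b * c) ≡ b * (a * c)
  swap′ = solve-∀
  sum₁ : ∀ s → (4 + 3 * s) + (5 + 6 * s) ≡ 9 + 9 * s
  sum₁ = solve-∀
  sum₂ : ∀ s → (3 + (4 + 3 * s)) + (6 + (5 + 6 * s)) ≡ 9 + 9 * suc s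
  sum₂ = solve-∀
  sum₃ : ∀ s → 3 + (4 + 3 * s) ≡ 4 + 3 * suc s
  sum₃ = solve-∀
  ratio : B′ * (rise₃ p * rise₆ q) ≡ B * rise₉ (9 + 9 * s)
  ratio = trans (cong (_* (rise₃ p * rise₆ q)) (sym (cong₂ _C_ (sum₂ s) (sum₃ s))))
         (trans (C-ratio p q) (cong (λ k → (k C p) * rise₉ k) (sum₁ s)))

geometric-growth : ∀ {a b k} (f : ℕ → ℕ) → (∀ s → a * f s ≤ b * f (suc s)) → k ≤ b * f 0 →
  ∀ s → k * a ^ s ≤ b * b ^ s * f s
geometric-growth {a} {b} {k} f grows base zero    = begin
  k * 1         ≡⟨ *-identityʳ k ⟩
  k             ≤⟨ base ⟩
  b * f 0       ≡⟨ cong (_* f 0) (*-identityʳ b) ⟨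
  b * 1 * f 0   ∎
  where open ≤-Reasoning
geometric-growth {a} {b} {k} f grows base (suc s) = begin
  k * (a * a ^ s)           ≡⟨ swap k a (a ^ s) ⟩
  a * (k * a ^ s)           ≤⟨ *-monoʳ-≤ a (geometric-growth {a} {b} {k} f grows base s) ⟩
  a * (b * b ^ s * f s)     ≡⟨ swap a (b * b ^ s) (f s) ⟩
  b * b ^ s * (a * f s)     ≤⟨ *-monoʳ-≤ (b * b ^ s) (grows s) ⟩
  b * b ^ s * (b * f (suc s)) ≡⟨ shuffle b (b ^ s) (f (suc s)) ⟩
  b * b ^ suc s * f (suc s) ∎
  where
  open ≤-Reasoning
  swap : ∀ a b c → a * (b * c) ≡ b * (a * c)
  swap = solve-∀
  shuffle : ∀ x y z → x * y * (x * z) ≡ x * (x * y) * z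
  shuffle = solve-∀

-- With r = s + 1 this says 20 * 5^(r - 1) * 10^(4r) * 8^(4r - 1) ≤ 7^(7r) * C(9r, 3r + 1), with the
-- powers sorted for induction on s. The base case is 126 = C(9, 4), and it holds with little room.
C-lower-bound : ∀ s →
  20 * (10 ^ 4 * 8 ^ 3) * (5 * (8 ^ 4 * 10 ^ 4)) ^ s ≤ 7 ^ 7 * (7 ^ 7) ^ s * ((9 + 9 * s) C (4 + 3 * s))
C-lower-bound = geometric-growth {5 * (8 ^ 4 * 10 ^ 4)} {7 ^ 7} {20 * (10 ^ 4 * 8 ^ 3)}
  (λ s → (9 + 9 * s) C (4 + 3 * s))
  (λ s → C-growth {5 * (8 ^ 4 * 10 ^ 4)} {7 ^ 7} s (rise-bound s))
  (≤ᵇ⇒≤ (20 * (10 ^ 4 * 8 ^ 3)) (7 ^ 7 * 126) tt)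

-- For h = m + 1 and r = h + k this is r ≤ h * 5^(r - h): a set smaller than r gains 5^(r - h) in
-- the percolation bound, which pays for having h in place of r in the denominator.
1+m+k≤[1+m]*5^k : ∀ m k → suc m + k ≤ suc m * 5 ^ k
1+m+k≤[1+m]*5^k m zero    = ≤-reflexive (trans (+-identityʳ (suc m)) (sym (*-identityʳ (suc m))))
1+m+k≤[1+m]*5^k m (suc k) = begin
  suc m + suc k             ≡⟨ +-suc (suc m) k ⟩
  1 + (suc m + k)           ≤⟨ +-mono-≤ (s≤s z≤n) ≤-refl ⟩
  (suc m + k) + (suc m + k) ≤⟨ +-mono-≤ (1+m+k≤[1+m]*5^k m k) (1+m+k≤[1+m]*5^k m k) ⟩
  x + x                     ≤⟨ m≤m+n (x + x) (3 * x) ⟩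
  x + x + 3 * x             ≡⟨ ring (suc m) (5 ^ k) ⟩
  suc m * 5 ^ suc k         ∎
  where
  open ≤-Reasoning
  x = suc m * 5 ^ k
  ring : ∀ m p → m * p + m * p + 3 * (m * p) ≡ m * (5 * p)
  ring = solve-∀

*^-distrib : ∀ a b n → (a * b) ^ n ≡ a ^ n * b ^ n
*^-distrib a b zero    = refl
*^-distrib a b (suc n) = trans (cong (a * b *_) (*^-distrib a b n)) (ring a b (a ^ n) (b ^ n))
  where
  ring : ∀ a b x y → a * b * (x * y) ≡ a * x * (b * y)
  ring = solve-∀

-- The parameters g, f, s, e, t stand for h - 1, r - h, r - 1, d - 1 and 4r - d, so that 1 ≤ h ≤ r
-- and 3r < d ≤ 4r hold without subtraction.
module _ (n N g f s e t : ℕ) (g+f≡s : g + f ≡ s) (10r≤n : 10 * suc s ≤ n) (h+N≡n : suc g + N ≡ n)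
         (3r≤e : 3 * suc s ≤ e) (d+t≡4r : suc e + t ≡ 4 * suc s) where

  private
    r h d X Y B : ℕ
    r = suc s
    h = suc g
    d = suc e
    X = 7 ^ (3 * r) * 7 ^ (4 * r)
    Y = 10 ^ (4 * r) * 8 ^ (3 + 4 * s)
    B = (9 + 9 * s) C (4 + 3 * s)

    9r≡ : ∀ s → 9 * suc s ≡ 9 + 9 * s
    9r≡ = solve-∀

    base : 20 * 5 ^ s * Y ≤ X * B
    base = begin
      20 * 5 ^ s * Y
        ≡⟨ cong (λ z → 20 * 5 ^ s * z) (cong₂ _*_ (powers 10) (^-distribˡ-+-* 8 3 (4 * s))) ⟩
      20 * 5 ^ s * (10 ^ 4 * 10 ^ (4 * s) * (8 ^ 3 * 8 ^ (4 * s)))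
        ≡⟨ shuffle 20 (5 ^ s) (10 ^ 4) (10 ^ (4 * s)) (8 ^ 3) (8 ^ (4 * s)) ⟩
      20 * (10 ^ 4 * 8 ^ 3) * (5 ^ s * (8 ^ (4 * s) * 10 ^ (4 * s)))
        ≡⟨ cong (20 * (10 ^ 4 * 8 ^ 3) *_) (trans (*^-distrib 5 (8 ^ 4 * 10 ^ 4) s) (cong (5 ^ s *_)
             (trans (*^-distrib (8 ^ 4) (10 ^ 4) s) (cong₂ _*_ (^-*-assoc 8 4 s) (^-*-assoc 10 4 s))))) ⟨
      20 * (10 ^ 4 * 8 ^ 3) * (5 * (8 ^ 4 * 10 ^ 4)) ^ s
        ≤⟨ C-lower-bound s ⟩
      7 ^ 7 * (7 ^ 7) ^ s * B
        ≡⟨ cong (λ z → 7 ^ 7 * z * B) (^-*-assoc 7 7 s) ⟩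
      7 ^ 7 * 7 ^ (7 * s) * B
        ≡⟨ cong (_* B) (trans (sym (^-distribˡ-+-* 7 7 (7 * s)))
             (trans (cong (7 ^_) (seven s)) (^-distribˡ-+-* 7 (3 * r) (4 * r)))) ⟩
      X * B ∎
      where
      open ≤-Reasoning
      four : ∀ s → 4 * suc s ≡ 4 + 4 * s
      four = solve-∀
      seven : ∀ s → 7 + 7 * s ≡ 3 * suc s + 4 * suc s
      seven = solve-∀
      powers : ∀ b → b ^ (4 * r) ≡ b ^ 4 * b ^ (4 * s)
      powers b = trans (cong (b ^_) (four s)) (^-distribˡ-+-* b 4 (4 * s))
      shuffle : ∀ a b c d e f → a * b * (c * d * (e * f)) ≡ a * (c * e) * (b * (f * d))
      shuffle = solve-∀

    h≤r : h ≤ r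
    h≤r = s≤s (subst (g ≤_) g+f≡s (m≤m+n g f))

    9r≤N : 9 * r ≤ N
    9r≤N = +-cancelˡ-≤ h (9 * r) N (begin
      h + 9 * r ≤⟨ +-monoˡ-≤ (9 * r) h≤r ⟩
      10 * r    ≤⟨ 10r≤n ⟩
      n         ≡⟨ h+N≡n ⟨
      h + N     ∎)
      where open ≤-Reasoning

    9n≤10N : 9 * n ≤ 10 * N
    9n≤10N = subst (λ z → 9 * z ≤ 10 * N) h+N≡n (begin
      9 * (h + N)   ≡⟨ *-distribˡ-+ 9 h N ⟩
      9 * h + 9 * N ≤⟨ +-monoˡ-≤ (9 * N) (≤-trans (*-monoʳ-≤ 9 h≤r) 9r≤N) ⟩
      10 * N        ∎)
      where open ≤-Reasoning

    -- Row 9r ascends up to its middle, and 3r + 1 ≤ d ≤ 4r stays below it, so `B` is at most C(9r,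
    -- d); `C-scaling` then passes from row 9r to row N.
    C-bound : N * B ≤ 9 * r * (N C d)
    C-bound = begin
      N * B               ≤⟨ *-monoʳ-≤ N (C-ascending {9 + 9 * s} low high) ⟩
      N * ((9 + 9 * s) C d) ≡⟨ cong (λ z → N * (z C d)) (9r≡ s) ⟨
      N * ((9 * r) C d)   ≤⟨ C-scaling e 9r≤N ⟩
      9 * r * (N C d)     ∎
      where
      open ≤-Reasoning
      low : 4 + 3 * s ≤ d
      low = s≤s (subst (_≤ e) (*-suc 3 s) 3r≤e)
      eight : ∀ s → 4 * suc s + 4 * suc s + (2 + s) ≡ suc (9 + 9 * s)
      eight = solve-∀
      d≤4r : d ≤ 4 * r
      d≤4r = subst (d ≤_) d+t≡4r (m≤m+n d t)
      high : d + d ≤ suc (9 + 9 * s)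
      high = begin
        d + d                       ≤⟨ +-mono-≤ d≤4r d≤4r ⟩
        4 * r + 4 * r               ≤⟨ m≤m+n _ (2 + s) ⟩
        4 * r + 4 * r + (2 + s)     ≡⟨ eight s ⟩
        suc (9 + 9 * s)             ∎

    scaled : 2 * n * 5 ^ g * Y ≤ h * X * (N C d)
    -- The factor 5^f completes 5^g to 5^s, 9 and 10 serve 9n ≤ 10N, and r is the factor later
    -- exchanged for h * 5^f.
    scaled = *-cancelˡ-≤ (90 * r * 5 ^ f) {{m*n≢0 (90 * r) (5 ^ f) {{_}} {{m^n≢0 5 f}}}} (begin
      90 * r * 5 ^ f * (2 * n * 5 ^ g * Y)
        ≡⟨ shuffle₁ r (5 ^ f) n (5 ^ g) Y ⟩
      9 * n * r * (20 * (5 ^ g * 5 ^ f) * Y)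
        ≡⟨ cong (λ z → 9 * n * r * (20 * z * Y)) (trans (sym (^-distribˡ-+-* 5 g f)) (cong (5 ^_) g+f≡s)) ⟩
      9 * n * r * (20 * 5 ^ s * Y)
        ≤⟨ *-mono-≤ (*-monoˡ-≤ r 9n≤10N) base ⟩
      10 * N * r * (X * B)
        ≡⟨ shuffle₂ N r X B ⟩
      10 * r * X * (N * B)
        ≤⟨ *-monoʳ-≤ (10 * r * X) C-bound ⟩
      10 * r * X * (9 * r * (N C d))
        ≤⟨ *-monoʳ-≤ (10 * r * X) (*-monoˡ-≤ (N C d) (*-monoʳ-≤ 9
             (subst (_≤ h * 5 ^ f) (cong suc g+f≡s) (1+m+k≤[1+m]*5^k g f)))) ⟩
      10 * r * X * (9 * (h * 5 ^ f) * (N C d))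
        ≡⟨ shuffle₃ r X h (5 ^ f) (N C d) ⟩
      90 * r * 5 ^ f * (h * X * (N C d)) ∎)
      where
      open ≤-Reasoning
      shuffle₁ : ∀ r f n g y → 90 * r * f * (2 * n * g * y) ≡ 9 * n * r * (20 * (g * f) * y)
      shuffle₁ = solve-∀
      shuffle₂ : ∀ N r x b → 10 * N * r * (x * b) ≡ 10 * r * x * (N * b)
      shuffle₂ = solve-∀
      shuffle₃ : ∀ r x h f c → 10 * r * x * (9 * (h * f) * c) ≡ 90 * r * f * (h * x * c)
      shuffle₃ = solve-∀

  -- The binomials on the left are bounded by C(k, i) 7^i ≤ 8^k, the one on the right by C(9r, 3r + 1).
  central-bound : 2 * n * 5 ^ (g + d) * ((e C (3 * r)) * ((4 * r) C d)) ≤ h * 4 ^ d * (N C d)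
  central-bound = *-cancelʳ-≤ _ _ X {{m*n≢0 (7 ^ (3 * r)) (7 ^ (4 * r)) {{m^n≢0 7 (3 * r)}} {{m^n≢0 7 (4 * r)}}}} (begin
    2 * n * 5 ^ (g + d) * ((e C (3 * r)) * ((4 * r) C d)) * X
      ≡⟨ cong₂ (λ u v → 2 * n * u * ((e C (3 * r)) * ((4 * r) C d)) * (7 ^ (3 * r) * v))
               (^-distribˡ-+-* 5 g d) (split 7) ⟩
    2 * n * (5 ^ g * 5 ^ d) * ((e C (3 * r)) * ((4 * r) C d)) * (7 ^ (3 * r) * (7 ^ d * 7 ^ t))
      ≡⟨ shuffle₁ n (5 ^ g) (5 ^ d) (e C (3 * r)) ((4 * r) C d) (7 ^ (3 * r)) (7 ^ d) (7 ^ t) ⟩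
    2 * n * 5 ^ g * (5 ^ d * ((e C (3 * r)) * 7 ^ (3 * r) * (((4 * r) C d) * 7 ^ d) * 7 ^ t))
      ≤⟨ *-monoʳ-≤ (2 * n * 5 ^ g) (*-monoʳ-≤ (5 ^ d)
           -- Base 7 is optimal for C(4r, d) at d = 7r/2, the middle of the window. Weakening 7^t to
           -- 10^t, together with 5 * 8 = 4 * 10, leaves 4^d as the only power depending on d, since
           -- 10^d * 10^t = 10^(4r).
           (*-mono-≤ (*-mono-≤ (C-power-bound 7 e (3 * r)) (C-power-bound 7 (4 * r) d))
                     (^-monoˡ-≤ t (≤ᵇ⇒≤ 7 10 tt)))) ⟩
    2 * n * 5 ^ g * (5 ^ d * (8 ^ e * 8 ^ (4 * r) * 10 ^ t))
      ≡⟨ cong (λ z → 2 * n * 5 ^ g * (5 ^ d * (8 ^ e * z * 10 ^ t))) (cong (8 ^_) (four s)) ⟩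
    2 * n * 5 ^ g * (5 ^ d * (8 ^ e * (8 * 8 ^ (3 + 4 * s)) * 10 ^ t))
      ≡⟨ shuffle₂ (2 * n * 5 ^ g) (5 ^ d) (8 ^ e) 8 (8 ^ (3 + 4 * s)) (10 ^ t) ⟩
    2 * n * 5 ^ g * ((5 ^ d * 8 ^ d) * (10 ^ t * 8 ^ (3 + 4 * s)))
      ≡⟨ cong (λ z → 2 * n * 5 ^ g * (z * (10 ^ t * 8 ^ (3 + 4 * s)))) (trans (sym (*^-distrib 5 8 d)) (*^-distrib 4 10 d)) ⟩
    2 * n * 5 ^ g * ((4 ^ d * 10 ^ d) * (10 ^ t * 8 ^ (3 + 4 * s)))
      ≡⟨ shuffle₃ (2 * n * 5 ^ g) (4 ^ d) (10 ^ d) (10 ^ t) (8 ^ (3 + 4 * s)) ⟩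
    4 ^ d * (2 * n * 5 ^ g * (10 ^ d * 10 ^ t * 8 ^ (3 + 4 * s)))
      ≡⟨ cong (λ z → 4 ^ d * (2 * n * 5 ^ g * (z * 8 ^ (3 + 4 * s)))) (split 10) ⟨
    4 ^ d * (2 * n * 5 ^ g * Y)
      ≤⟨ *-monoʳ-≤ (4 ^ d) scaled ⟩
    4 ^ d * (h * X * (N C d))
      ≡⟨ shuffle₄ (4 ^ d) h X (N C d) ⟩
    h * 4 ^ d * (N C d) * X ∎)
    where
    open ≤-Reasoning
    four : ∀ s → 4 * suc s ≡ 4 + 4 * s
    four = solve-∀
    split : ∀ b → b ^ (4 * r) ≡ b ^ d * b ^ t
    split b = trans (cong (b ^_) (sym d+t≡4r)) (^-distribˡ-+-* b d t)
    shuffle₁ : ∀ n g d c c′ x y z → 2 * n * (g * d) * (c * c′) * (x * (y * z)) ≡ 2 * n * g * (d * (c * x * (c′ * y) * z))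
    shuffle₁ = solve-∀
    shuffle₂ : ∀ a b c k d e → a * (b * (c * (k * d) * e)) ≡ a * ((b * (k * c)) * (e * d))
    shuffle₂ = solve-∀
    shuffle₃ : ∀ a b c d e → a * ((b * c) * (d * e)) ≡ b * (a * (c * d * e))
    shuffle₃ = solve-∀
    shuffle₄ : ∀ a h x c → a * (h * x * c) ≡ h * a * c * x
    shuffle₄ = solve-∀

-- Finite sums

private variable
  A B P Q : Set
  n : ℕ

infixr 5 _▸_

-- The Iverson bracket [P] times k. Restricted sums are written as full sums of guarded terms, so
-- that their order can be exchanged freely.
_▸_ : Dec P → ℕ → ℕ
P? ▸ k = if does P? then k else 0

▸-yes : ∀ (P? : Dec P) {k} → P → P? ▸ k ≡ k
▸-yes (yes _) p = refl
▸-yes (no ¬p) p = contradiction p ¬p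

▸-no : ∀ (P? : Dec P) {k} → ¬ P → P? ▸ k ≡ 0
▸-no (yes p) ¬p = contradiction p ¬p
▸-no (no _)  ¬p = refl

▸-bound : ∀ (P? : Dec P) {j k} → (P → j ≤ k) → P? ▸ j ≤ k
▸-bound (yes p) h = h p
▸-bound (no _)  h = z≤n

▸-mono : ∀ (P? : Dec P) (Q? : Dec Q) {j k} → (P → Q) → (P → j ≤ k) → P? ▸ j ≤ Q? ▸ k
▸-mono P? Q? f h = ▸-bound P? λ p → ≤-trans (h p) (≤-reflexive (sym (▸-yes Q? (f p))))

▸-cong : ∀ (P? : Dec P) {j k} → (P → j ≡ k) → P? ▸ j ≡ P? ▸ k
▸-cong (yes p) h = h p
▸-cong (no _)  h = refl

▸-positive : ∀ (P? : Dec P) {k} → 0 < P? ▸ k → P × 0 < k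
▸-positive (yes p) 0<k = p , 0<k

▸-*ˡ : ∀ (P? : Dec P) j k → P? ▸ j * k ≡ j * (P? ▸ k)
▸-*ˡ (yes _) j k = refl
▸-*ˡ (no _)  j k = sym (*-zeroʳ j)

▸-+ : ∀ (P? : Dec P) j k → P? ▸ (j + k) ≡ (P? ▸ j) + (P? ▸ k)
▸-+ (yes _) j k = refl
▸-+ (no _)  j k = refl

∑ : List A → (A → ℕ) → ℕ
∑ []       f = 0
∑ (x ∷ xs) f = f x + ∑ xs f

∑-mono : ∀ (xs : List A) {f g} → (∀ x → f x ≤ g x) → ∑ xs f ≤ ∑ xs g
∑-mono []       f≤g = z≤n
∑-mono (x ∷ xs) f≤g = +-mono-≤ (f≤g x) (∑-mono xs f≤g)

∑-cong : ∀ (xs : List A) {f g} → (∀ x → f x ≡ g x) → ∑ xs f ≡ ∑ xs g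
∑-cong []       f≡g = refl
∑-cong (x ∷ xs) f≡g = cong₂ _+_ (f≡g x) (∑-cong xs f≡g)

∑-+ : ∀ (xs : List A) f g → ∑ xs (λ x → f x + g x) ≡ ∑ xs f + ∑ xs g
∑-+ []       f g = refl
∑-+ (x ∷ xs) f g = trans (cong (f x + g x +_) (∑-+ xs f g)) (ring (f x) (g x) (∑ xs f) (∑ xs g))
  where
  ring : ∀ a b c d → a + b + (c + d) ≡ a + c + (b + d)
  ring = solve-∀

∑-*ˡ : ∀ (xs : List A) k f → ∑ xs (λ x → k * f x) ≡ k * ∑ xs f
∑-*ˡ []       k f = sym (*-zeroʳ k)
∑-*ˡ (x ∷ xs) k f = trans (cong (k * f x +_) (∑-*ˡ xs k f)) (sym (*-distribˡ-+ k (f x) (∑ xs f)))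

∑-const : ∀ (xs : List A) k → ∑ xs (λ _ → k) ≡ length xs * k
∑-const []       k = refl
∑-const (x ∷ xs) k = cong (k +_) (∑-const xs k)

∑-swap : ∀ (xs : List A) (ys : List B) (f : A → B → ℕ) → ∑ xs (λ x → ∑ ys (f x)) ≡ ∑ ys (λ y → ∑ xs (λ x → f x y))
∑-swap []       ys f = sym (trans (∑-const ys 0) (*-zeroʳ (length ys)))
∑-swap (x ∷ xs) ys f = trans (cong (∑ ys (f x) +_) (∑-swap xs ys f)) (sym (∑-+ ys (f x) (λ y → ∑ xs (λ x → f x y))))

▸-∑ : ∀ (P? : Dec P) (xs : List A) f → P? ▸ ∑ xs f ≡ ∑ xs (λ x → P? ▸ f x)
▸-∑ (yes _) xs f = refl
▸-∑ (no _)  xs f = sym (trans (∑-const xs 0) (*-zeroʳ (length xs)))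

∑-++ : ∀ (xs ys : List A) f → ∑ (xs ++ ys) f ≡ ∑ xs f + ∑ ys f
∑-++ []       ys f = refl
∑-++ (x ∷ xs) ys f = trans (cong (f x +_) (∑-++ xs ys f)) (sym (+-assoc (f x) (∑ xs f) (∑ ys f)))

∑-map : ∀ (h : A → B) xs f → ∑ (map h xs) f ≡ ∑ xs (f ∘ h)
∑-map h []       f = refl
∑-map h (x ∷ xs) f = cong (f (h x) +_) (∑-map h xs f)

∑-member : ∀ {xs : List A} {x} f → x ∈ₗ xs → f x ≤ ∑ xs f
∑-member f (hereₗ refl)             = m≤m+n _ _
∑-member {xs = y ∷ _} f (thereₗ x∈) = ≤-trans (∑-member f x∈) (m≤n+m _ (f y))

∑-at-most-one : ∀ {xs : List A} {P : A → Set} (P? : ∀ x → Dec (P x)) k → Unique xs →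
  (∀ {x y} → P x → P y → x ≡ y) → ∑ xs (λ x → P? x ▸ k) ≤ k
∑-at-most-one P? k [] unique = z≤n
∑-at-most-one {xs = x ∷ xs} P? k (x∉ ∷ u) unique with P? x
... | no _  = ∑-at-most-one P? k u unique
... | yes p = ≤-reflexive (trans (cong (k +_) (rest xs x∉)) (+-identityʳ k))
  where
  rest : ∀ ys → All (x ≢_) ys → ∑ ys (λ y → P? y ▸ k) ≡ 0
  rest []       []        = refl
  rest (y ∷ ys) (x≢y ∷ a) = cong₂ _+_ (▸-no (P? y) (λ q → x≢y (unique p q))) (rest ys a)

-- Each f x is charged to the term at τ x; summing over y outermost, no y is charged twice.
-- Everything is asked only where f is positive, so τ may be arbitrary elsewhere.
∑-inject : ∀ {xs : List A} {ys : List B} (_≟ᴮ_ : DecidableEquality B) (τ : A → B) {f g} → Unique xs →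
  (∀ x → 0 < f x → τ x ∈ₗ ys × f x ≤ g (τ x)) →
  (∀ {x y} → 0 < f x → 0 < f y → τ x ≡ τ y → x ≡ y) →
  ∑ xs f ≤ ∑ ys g
∑-inject {A} {B} {xs} {ys} _≟ᴮ_ τ {f} {g} unique hits injective = begin
  ∑ xs f                                 ≤⟨ ∑-mono xs spread ⟩
  ∑ xs (λ x → ∑ ys (λ y → hit? x y ▸ g y)) ≡⟨ ∑-swap xs ys _ ⟩
  ∑ ys (λ y → ∑ xs (λ x → hit? x y ▸ g y)) ≤⟨ ∑-mono ys (λ y → ∑-at-most-one (λ x → hit? x y) (g y) unique
      (λ (p , τx≡y) (q , τx′≡y) → injective p q (trans τx≡y (sym τx′≡y)))) ⟩
  ∑ ys g                                 ∎
  where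
  open ≤-Reasoning
  hit? : ∀ x y → Dec (0 < f x × τ x ≡ y)
  hit? x y = (0 <? f x) ×-dec (τ x ≟ᴮ y)
  spread : ∀ x → f x ≤ ∑ ys (λ y → hit? x y ▸ g y)
  spread x = from (0 <? f x)
    where
    from : Dec (0 < f x) → f x ≤ ∑ ys (λ y → hit? x y ▸ g y)
    from (no ¬p) = ≤-trans (≮⇒≥ ¬p) z≤n
    from (yes p) with member , fx≤ ← hits x p = ≤-trans fx≤ (≤-trans
      (≤-reflexive (sym (▸-yes (hit? x (τ x)) (p , refl))))
      (∑-member (λ y → hit? x y ▸ g y) member))

∣p∣≡∑ : ∀ {n} (p : Subset n) → ∣ p ∣ ≡ ∑ (allFin n) (λ v → (v ∈? p) ▸ 1)
∣p∣≡∑ []            = refl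
∣p∣≡∑ {suc n} (s ∷ p) = trans (head s) (cong (λ z → ((zero ∈? (s ∷ p)) ▸ 1) + z) (sym tail))
  where
  head : ∀ s → ∣ s ∷ p ∣ ≡ ((zero ∈? (s ∷ p)) ▸ 1) + ∑ (allFin n) (λ v → (v ∈? p) ▸ 1)
  head true  = cong suc (∣p∣≡∑ p)
  head false = ∣p∣≡∑ p
  tail : ∑ (Data.List.tabulate Fin.suc) (λ v → (v ∈? (s ∷ p)) ▸ 1) ≡ ∑ (allFin n) (λ v → (v ∈? p) ▸ 1)
  tail = trans (cong (λ xs → ∑ xs (λ v → (v ∈? (s ∷ p)) ▸ 1)) (sym (map-tabulate (λ z → z) suc)))
               (∑-map suc (allFin n) (λ v → (v ∈? (s ∷ p)) ▸ 1))

-- Counting subsets and supersets by size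

subsets : ∀ n → List (Subset n)
subsets zero    = [] ∷ []
subsets (suc n) = map (inside ∷_) (subsets n) ++ map (outside ∷_) (subsets n)

∈-subsets : ∀ {n} (p : Subset n) → p ∈ₗ subsets n
∈-subsets []              = hereₗ refl
∈-subsets (true ∷ p)      = ∈-++⁺ˡ (∈-map⁺ (inside ∷_) (∈-subsets p))
∈-subsets {suc n} (false ∷ p) = ∈-++⁺ʳ (map (inside ∷_) (subsets n)) (∈-map⁺ (outside ∷_) (∈-subsets p))

subsets-unique : ∀ n → Unique (subsets n)
subsets-unique zero    = [] ∷ []
subsets-unique (suc n) = Unique.++⁺ (Unique.map⁺ ∷-injectiveʳ (subsets-unique n)) (Unique.map⁺ ∷-injectiveʳ (subsets-unique n)) disjoint
  where
  disjoint : ∀ {p} → ¬ (p ∈ₗ map (inside ∷_) (subsets n) × p ∈ₗ map (outside ∷_) (subsets n))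
  disjoint (p , q) with ∈-map⁻ (inside ∷_) p | ∈-map⁻ (outside ∷_) q
  ... | _ , _ , refl | _ , _ , ()

_≟ₛ_ : ∀ {n} → DecidableEquality (Subset n)
_≟ₛ_ = ≡-dec Bool._≟_

∑-subsets-suc : ∀ n (f : Subset (suc n) → ℕ) →
  ∑ (subsets (suc n)) f ≡ ∑ (subsets n) (f ∘ (inside ∷_)) + ∑ (subsets n) (f ∘ (outside ∷_))
∑-subsets-suc n f = trans (∑-++ (map (inside ∷_) (subsets n)) _ f)
  (cong₂ _+_ (∑-map (inside ∷_) (subsets n) f) (∑-map (outside ∷_) (subsets n) f))

▸-iff : ∀ (P? : Dec P) (Q? : Dec Q) {k} → (P → Q) → (Q → P) → P? ▸ k ≡ Q? ▸ k
▸-iff P? Q? f g = ≤-antisym (▸-mono P? Q? f (λ _ → ≤-refl)) (▸-mono Q? P? g (λ _ → ≤-refl))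

∑-zero : ∀ (xs : List A) {f} → (∀ x → f x ≡ 0) → ∑ xs f ≡ 0
∑-zero xs f≡0 = trans (∑-cong xs f≡0) (trans (∑-const xs 0) (*-zeroʳ (length xs)))

∑-none : ∀ (xs : List A) {P : A → Set} (P? : ∀ x → Dec (P x)) → (∀ x → ¬ P x) → ∑ xs (λ x → P? x ▸ 1) ≡ 0
∑-none xs P? none = ∑-zero xs λ x → ▸-no (P? x) (none x)

∑-iff : ∀ (xs : List A) {P Q : A → Set} (P? : ∀ x → Dec (P x)) (Q? : ∀ x → Dec (Q x)) →
  (∀ x → P x → Q x) → (∀ x → Q x → P x) → ∑ xs (λ x → P? x ▸ 1) ≡ ∑ xs (λ x → Q? x ▸ 1)
∑-iff xs P? Q? f g = ∑-cong xs λ x → ▸-iff (P? x) (Q? x) (f x) (g x)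

sizedSubset? : ∀ {n} (X : Subset n) j B → Dec (∣ B ∣ ≡ j × B ⊆ X)
sizedSubset? X j B = (∣ B ∣ ≟ j) ×-dec (B ⊆? X)

sizedSuperset? : ∀ {n} (T : Subset n) k S → Dec (∣ S ∣ ≡ k × T ⊆ S)
sizedSuperset? T k S = (∣ S ∣ ≟ k) ×-dec (T ⊆? S)

zero∉outside : ∀ {n} {p : Subset n} → zero ∉ outside ∷ p
zero∉outside ()

∑-subsets-of-size : ∀ {n} (X : Subset n) j → ∑ (subsets n) (λ B → sizedSubset? X j B ▸ 1) ≡ ∣ X ∣ C j
∑-subsets-of-size []                  zero    = refl
∑-subsets-of-size []                  (suc j) = refl
∑-subsets-of-size {suc n} (true ∷ X)  zero    = trans (∑-subsets-suc n _) (cong₂ _+_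
  (∑-none (subsets n) (λ B → sizedSubset? (true ∷ X) 0 (true ∷ B)) λ { _ (() , _) })
  (trans (∑-iff (subsets n) (λ B → sizedSubset? (true ∷ X) 0 (false ∷ B)) (sizedSubset? X 0)
           (λ _ (e , s) → e , drop-∷-⊆ s) (λ _ (e , s) → e , out⊆ s))
         (∑-subsets-of-size X zero)))
∑-subsets-of-size {suc n} (true ∷ X)  (suc j) = trans (∑-subsets-suc n _) (trans (cong₂ _+_
  (trans (∑-iff (subsets n) (λ B → sizedSubset? (true ∷ X) (suc j) (true ∷ B)) (sizedSubset? X j)
           (λ _ (e , s) → suc-injective e , drop-∷-⊆ s) (λ _ (e , s) → cong suc e , in⊆in s))
         (∑-subsets-of-size X j))
  (trans (∑-iff (subsets n) (λ B → sizedSubset? (true ∷ X) (suc j) (false ∷ B)) (sizedSubset? X (suc j))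
           (λ _ (e , s) → e , drop-∷-⊆ s) (λ _ (e , s) → e , out⊆ s))
         (∑-subsets-of-size X (suc j))))
  (nCk+nC[k+1]≡[n+1]C[k+1] ∣ X ∣ j))
∑-subsets-of-size {suc n} (false ∷ X) j       = trans (∑-subsets-suc n _) (cong₂ _+_
  (∑-none (subsets n) (λ B → sizedSubset? (false ∷ X) j (true ∷ B)) λ _ (_ , s) → zero∉outside (s here))
  (trans (∑-iff (subsets n) (λ B → sizedSubset? (false ∷ X) j (false ∷ B)) (sizedSubset? X j)
           (λ _ (e , s) → e , drop-∷-⊆ s) (λ _ (e , s) → e , out⊆ s))
         (∑-subsets-of-size X j)))

-- Removing T turns these sets into the m-subsets of `∁ T`; a vertex outside T is either taken or
-- not, which is Pascal's rule.
∑-supersets-of-size : ∀ {n} (T : Subset n) m →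
  ∑ (subsets n) (λ S → sizedSuperset? T (∣ T ∣ + m) S ▸ 1) ≡ ∣ ∁ T ∣ C m
∑-supersets-of-size []                  zero    = refl
∑-supersets-of-size []                  (suc m) = refl
∑-supersets-of-size {suc n} (true ∷ T)  m       = trans (∑-subsets-suc n _) (trans (cong₂ _+_
  (trans (∑-iff (subsets n) (λ S → sizedSuperset? (true ∷ T) (suc (∣ T ∣ + m)) (true ∷ S)) (sizedSuperset? T (∣ T ∣ + m))
           (λ _ (e , s) → suc-injective e , drop-∷-⊆ s) (λ _ (e , s) → cong suc e , in⊆in s))
         (∑-supersets-of-size T m))
  (∑-none (subsets n) (λ S → sizedSuperset? (true ∷ T) (suc (∣ T ∣ + m)) (false ∷ S))
    λ _ (_ , s) → zero∉outside (s here)))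
  (+-identityʳ _))
∑-supersets-of-size {suc n} (false ∷ T) zero    = trans (∑-subsets-suc n _) (cong₂ _+_
  (∑-none (subsets n) (λ S → sizedSuperset? (false ∷ T) (∣ T ∣ + 0) (true ∷ S)) λ _ (e , s) →
    1+n≰n (≤-trans (≤-reflexive (trans e (+-identityʳ _))) (p⊆q⇒∣p∣≤∣q∣ (drop-∷-⊆ s))))
  (trans (∑-iff (subsets n) (λ S → sizedSuperset? (false ∷ T) (∣ T ∣ + 0) (false ∷ S)) (sizedSuperset? T (∣ T ∣ + 0))
           (λ _ (e , s) → e , drop-∷-⊆ s) (λ _ (e , s) → e , out⊆ s))
         (∑-supersets-of-size T zero)))
∑-supersets-of-size {suc n} (false ∷ T) (suc m) = trans (∑-subsets-suc n _) (trans (cong₂ _+_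
  (trans (∑-iff (subsets n) (λ S → sizedSuperset? (false ∷ T) (∣ T ∣ + suc m) (true ∷ S)) (sizedSuperset? T (∣ T ∣ + m))
           (λ _ (e , s) → suc-injective (trans e (+-suc ∣ T ∣ m)) , drop-∷-⊆ s)
           (λ _ (e , s) → trans (cong suc e) (sym (+-suc ∣ T ∣ m)) , out⊆ s))
         (∑-supersets-of-size T m))
  (trans (∑-iff (subsets n) (λ S → sizedSuperset? (false ∷ T) (∣ T ∣ + suc m) (false ∷ S)) (sizedSuperset? T (∣ T ∣ + suc m))
           (λ _ (e , s) → e , drop-∷-⊆ s) (λ _ (e , s) → e , out⊆ s))
         (∑-supersets-of-size T (suc m))))
  (nCk+nC[k+1]≡[n+1]C[k+1] ∣ ∁ T ∣ m))

-- Connected vertex sets and percolation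

comprehension : {P : Fin n → Set} → (∀ v → Dec (P v)) → Subset n
comprehension P? = tabulate (λ v → does (P? v))

∈-comprehension⁺ : ∀ {P : Fin n → Set} (P? : ∀ v → Dec (P v)) {v} → P v → v ∈ comprehension P?
∈-comprehension⁺ P? {v} p = lookup⇒[]= v _ (trans (lookup∘tabulate _ v) (dec-true (P? v) p))

∈-comprehension⁻ : ∀ {P : Fin n → Set} (P? : ∀ v → Dec (P v)) {v} → v ∈ comprehension P? → P v
∈-comprehension⁻ P? {v} v∈ = from (P? v) (trans (sym (lookup∘tabulate _ v)) ([]=⇒lookup v∈))
  where
  from : ∀ {Q : Set} (Q? : Dec Q) → does Q? ≡ true → Q
  from (yes q) _ = q

∣p∪q∣≡∣p∣+∣q∣ : ∀ (p q : Subset n) → (∀ {x} → x ∈ p → x ∉ q) → ∣ p ∪ q ∣ ≡ ∣ p ∣ + ∣ q ∣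
∣p∪q∣≡∣p∣+∣q∣ []          []          disjoint = refl
∣p∪q∣≡∣p∣+∣q∣ (true ∷ p)  (true ∷ q)  disjoint = contradiction here (disjoint here)
∣p∪q∣≡∣p∣+∣q∣ (true ∷ p)  (false ∷ q) disjoint = cong suc (∣p∪q∣≡∣p∣+∣q∣ p q (λ x∈ x∈′ → disjoint (there x∈) (there x∈′)))
∣p∪q∣≡∣p∣+∣q∣ (false ∷ p) (true ∷ q)  disjoint = trans (cong suc (∣p∪q∣≡∣p∣+∣q∣ p q (λ x∈ x∈′ → disjoint (there x∈) (there x∈′))))
                                                       (sym (+-suc ∣ p ∣ ∣ q ∣))
∣p∪q∣≡∣p∣+∣q∣ (false ∷ p) (false ∷ q) disjoint = ∣p∪q∣≡∣p∣+∣q∣ p q (λ x∈ x∈′ → disjoint (there x∈) (there x∈′))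

∣p∪⁅x⁆∣≡1+∣p∣ : ∀ (p : Subset n) {x} → x ∉ p → ∣ p ∪ ⁅ x ⁆ ∣ ≡ suc ∣ p ∣
∣p∪⁅x⁆∣≡1+∣p∣ p {x} x∉p = trans
  (∣p∪q∣≡∣p∣+∣q∣ p ⁅ x ⁆ (λ y∈p y∈⁅x⁆ → x∉p (subst (_∈ p) (x∈⁅y⁆⇒x≡y x y∈⁅x⁆) y∈p)))
  (trans (cong (∣ p ∣ +_) (∣⁅x⁆∣≡1 x)) (+-comm ∣ p ∣ 1))

module _ (G : Graph n) where

  Touches : Subset n → Fin n → Set
  Touches A v = ∃ λ x → x ∈ A × adj G x v ≡ true

  touches? : ∀ A v → Dec (Touches A v)
  touches? A v = any? λ x → (x ∈? A) ×-dec (adj G x v Bool.≟ true)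

  near? : ∀ A v → Dec (v ∉ A × Touches A v)
  near? A v = ¬? (v ∈? A) ×-dec touches? A v

  far? : ∀ A v → Dec (v ∉ A × ¬ Touches A v)
  far? A v = ¬? (v ∈? A) ×-dec ¬? (touches? A v)

  -- The sizes of these sets are d(A) and c(A).
  near far : Subset n → Subset n
  near A = comprehension (near? A)
  far  A = comprehension (far? A)

  ∣A∣+∣near∣+∣far∣≡n : ∀ A → ∣ A ∣ + ∣ near A ∣ + ∣ far A ∣ ≡ n
  ∣A∣+∣near∣+∣far∣≡n A = trans (sym (trans
      (∣p∪q∣≡∣p∣+∣q∣ (A ∪ near A) (far A) disjoint)
      (cong (_+ ∣ far A ∣) (∣p∪q∣≡∣p∣+∣q∣ A (near A) (λ x∈A x∈near → proj₁ (∈-comprehension⁻ (near? A) x∈near) x∈A)))))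
    (trans (cong ∣_∣ (⊆-antisym ⊆⊤ (λ {x} _ → exhaustive x))) (∣⊤∣≡n n))
    where
    disjoint : ∀ {x} → x ∈ A ∪ near A → x ∉ far A
    disjoint x∈ x∈far with x∈p∪q⁻ A (near A) x∈ | ∈-comprehension⁻ (far? A) x∈far
    ... | inj₁ x∈A    | x∉A , _ = x∉A x∈A
    ... | inj₂ x∈near | _ , ¬t = ¬t (proj₂ (∈-comprehension⁻ (near? A) x∈near))
    exhaustive : ∀ x → x ∈ (A ∪ near A) ∪ far A
    exhaustive x with x ∈? A | touches? A x
    ... | yes x∈A | _      = x∈p∪q⁺ (inj₁ (x∈p∪q⁺ (inj₁ x∈A)))
    ... | no  x∉A | yes t  = x∈p∪q⁺ (inj₁ (x∈p∪q⁺ (inj₂ (∈-comprehension⁺ (near? A) (x∉A , t)))))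
    ... | no  x∉A | no  ¬t = x∈p∪q⁺ (inj₂ (∈-comprehension⁺ (far? A) (x∉A , ¬t)))

  -- A set inducing a connected subgraph is encoded as one that no proper nonempty subset splits off without a
  -- crossing edge, which is decidable by searching all subsets.
  Split : Subset n → Subset n → Set
  Split A U = U ⊆ A × Nonempty U × (∃ λ y → y ∈ A × y ∉ U) ×
              (∀ x y → x ∈ U → y ∈ A → y ∉ U → adj G x y ≡ false)

  Unsplittable : Subset n → Set
  Unsplittable A = ¬ ∃ (Split A)

  unsplittable? : ∀ A → Dec (Unsplittable A)
  unsplittable? A = ¬? (anySubset? λ U → (U ⊆? A) ×-dec (nonempty? U ×-dec
    ((any? λ y → (y ∈? A) ×-dec ¬? (y ∈? U)) ×-dec
     (all? λ x → all? λ y → (x ∈? U) →-dec ((y ∈? A) →-dec (¬? (y ∈? U) →-dec (adj G x y Bool.≟ false)))))))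

  -- Otherwise U would itself split A, as all neighbours of U lie outside A.
  unsplittable-crossing : ∀ {A U} → Unsplittable A → Nonempty U → U ⊆ A → near U ⊆ ∁ A → A ⊆ U
  unsplittable-crossing {A} {U} unsplittable nonempty U⊆A near⊆ {y} y∈A with y ∈? U
  ... | yes y∈U = y∈U
  ... | no  y∉U = ⊥-elim (unsplittable (U , U⊆A , nonempty , (y , y∈A , y∉U) , λ x z x∈U z∈A z∉U →
          ¬-not λ edge → x∈∁p⇒x∉p (near⊆ (∈-comprehension⁺ (near? U) (z∉U , x , x∈U , edge))) z∈A))

  weight : Subset n → ℕ
  weight A = 4 ^ ∣ near A ∣ * 5 ^ ∣ far A ∣

  between? : ∀ A₀ X A → Dec (Unsplittable A × A₀ ⊆ A × X ⊆ ∁ A)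
  between? A₀ X A = unsplittable? A ×-dec ((A₀ ⊆? A) ×-dec (X ⊆? ∁ A))

  -- Up to the factor 5 ^ n: if every vertex is open with probability 1/5, the cluster of a vertex of A₀ contains
  -- A₀ and avoids X with probability at most (1/5) ^ ∣ A₀ ∣ * (4/5) ^ ∣ X ∣. The proof reveals one vertex next to A₀
  -- at a time.
  percolation : ∀ k A₀ X → Nonempty A₀ → X ⊆ near A₀ → ∣ A₀ ∣ + ∣ X ∣ + k ≡ n →
    ∑ (subsets n) (λ A → between? A₀ X A ▸ weight A) ≤ 4 ^ ∣ X ∣ * 5 ^ k
  percolation k A₀ X (z , z∈A₀) X⊆near size = explore k size (any? λ u → (u ∈? near A₀) ×-dec ¬? (u ∈? X))
    where
    open ≤-Reasoning
    explore : ∀ k → ∣ A₀ ∣ + ∣ X ∣ + k ≡ n → Dec (∃ λ u → u ∈ near A₀ × u ∉ X) →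
      ∑ (subsets n) (λ A → between? A₀ X A ▸ weight A) ≤ 4 ^ ∣ X ∣ * 5 ^ k
    -- With every neighbour of A₀ known to be closed, the cluster is A₀ itself and `near A₀` is X.
    explore k size (no explored) = begin
      ∑ (subsets n) (λ A → between? A₀ X A ▸ weight A) ≤⟨ ∑-mono (subsets n) only ⟩
      ∑ (subsets n) (λ A → (A ≟ₛ A₀) ▸ weight A₀)     ≤⟨ ∑-at-most-one (_≟ₛ A₀) (weight A₀) (subsets-unique n) (λ p q → trans p (sym q)) ⟩
      weight A₀                                       ≡⟨ cong₂ (λ a b → 4 ^ a * 5 ^ b) (cong ∣_∣ near≡X) far≡k ⟩
      4 ^ ∣ X ∣ * 5 ^ k                               ∎
      where
      near⊆X : near A₀ ⊆ X
      near⊆X {u} u∈near with u ∈? X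
      ... | yes u∈X = u∈X
      ... | no  u∉X = contradiction (u , u∈near , u∉X) explored
      near≡X : near A₀ ≡ X
      near≡X = ⊆-antisym near⊆X X⊆near
      far≡k : ∣ far A₀ ∣ ≡ k
      far≡k = +-cancelˡ-≡ (∣ A₀ ∣ + ∣ X ∣) _ _ (trans
        (subst (λ Y → ∣ A₀ ∣ + ∣ Y ∣ + ∣ far A₀ ∣ ≡ n) near≡X (∣A∣+∣near∣+∣far∣≡n A₀)) (sym size))
      only : ∀ A → between? A₀ X A ▸ weight A ≤ (A ≟ₛ A₀) ▸ weight A₀
      only A = ▸-bound (between? A₀ X A) λ (unsplittable , A₀⊆A , X⊆∁A) →
        let A≡A₀ = ⊆-antisym (unsplittable-crossing unsplittable (z , z∈A₀) A₀⊆A (X⊆∁A ∘ near⊆X)) A₀⊆A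
        in ≤-reflexive (trans (cong weight A≡A₀) (sym (▸-yes (A ≟ₛ A₀) A≡A₀)))
    explore k size (yes (u , u∈near , u∉X)) = branch k size
      where
      u∉A₀ : u ∉ A₀
      u∉A₀ = proj₁ (∈-comprehension⁻ (near? A₀) u∈near)
      A₁ X₁ : Subset n
      A₁ = A₀ ∪ ⁅ u ⁆
      X₁ = X ∪ ⁅ u ⁆
      near-A₁ : X ⊆ near A₁
      near-A₁ {x} x∈X with ∈-comprehension⁻ (near? A₀) (X⊆near x∈X)
      ... | x∉A₀ , y , y∈A₀ , edge = ∈-comprehension⁺ (near? A₁)
            ((λ x∈A₁ → [ x∉A₀ , (λ x∈⁅u⁆ → u∉X (subst (_∈ X) (x∈⁅y⁆⇒x≡y u x∈⁅u⁆) x∈X)) ]′ (x∈p∪q⁻ A₀ ⁅ u ⁆ x∈A₁))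
            , y , x∈p∪q⁺ (inj₁ y∈A₀) , edge)
      near-X₁ : X₁ ⊆ near A₀
      near-X₁ x∈X₁ with x∈p∪q⁻ X ⁅ u ⁆ x∈X₁
      ... | inj₁ x∈X   = X⊆near x∈X
      ... | inj₂ x∈⁅u⁆ = subst (_∈ near A₀) (sym (x∈⁅y⁆⇒x≡y u x∈⁅u⁆)) u∈near
      undecided : ∣ A₀ ∣ + suc ∣ X ∣ ≤ n
      undecided = subst (_≤ n) (trans (∣p∪q∣≡∣p∣+∣q∣ A₀ X₁ (λ x∈A₀ x∈X₁ → proj₁ (∈-comprehension⁻ (near? A₀) (near-X₁ x∈X₁)) x∈A₀))
        (cong (∣ A₀ ∣ +_) (∣p∪⁅x⁆∣≡1+∣p∣ X u∉X))) (∣p∣≤n (A₀ ∪ X₁))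
      dichotomy : ∀ A → between? A₀ X A ▸ weight A ≤ (between? A₁ X A ▸ weight A) + (between? A₀ X₁ A ▸ weight A)
      dichotomy A = ▸-bound (between? A₀ X A) λ (unsplittable , A₀⊆A , X⊆∁A) →
        case-of (u ∈? A) unsplittable A₀⊆A X⊆∁A
        where
        case-of : Dec (u ∈ A) → Unsplittable A → A₀ ⊆ A → X ⊆ ∁ A →
          weight A ≤ (between? A₁ X A ▸ weight A) + (between? A₀ X₁ A ▸ weight A)
        case-of (yes u∈A) c i e = ≤-trans (≤-reflexive (sym (▸-yes (between? A₁ X A) (c , grown , e)))) (m≤m+n _ _)
          where
          grown : A₁ ⊆ A
          grown x∈A₁ with x∈p∪q⁻ A₀ ⁅ u ⁆ x∈A₁
          ... | inj₁ x∈A₀  = i x∈A₀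
          ... | inj₂ x∈⁅u⁆ = subst (_∈ A) (sym (x∈⁅y⁆⇒x≡y u x∈⁅u⁆)) u∈A
        case-of (no u∉A) c i e = ≤-trans (≤-reflexive (sym (▸-yes (between? A₀ X₁ A) (c , i , avoided)))) (m≤n+m _ _)
          where
          avoided : X₁ ⊆ ∁ A
          avoided x∈X₁ with x∈p∪q⁻ X ⁅ u ⁆ x∈X₁
          ... | inj₁ x∈X   = e x∈X
          ... | inj₂ x∈⁅u⁆ = subst (_∈ ∁ A) (sym (x∈⁅y⁆⇒x≡y u x∈⁅u⁆)) (x∉p⇒x∈∁p u∉A)
      branch : ∀ k → ∣ A₀ ∣ + ∣ X ∣ + k ≡ n → ∑ (subsets n) (λ A → between? A₀ X A ▸ weight A) ≤ 4 ^ ∣ X ∣ * 5 ^ k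
      branch zero size = contradiction (≤-trans (≤-reflexive (sym (+-suc ∣ A₀ ∣ ∣ X ∣)))
        (≤-trans undecided (≤-reflexive (trans (sym size) (+-identityʳ _))))) 1+n≰n
      branch (suc k) size = begin
        ∑ (subsets n) (λ A → between? A₀ X A ▸ weight A)
          ≤⟨ ∑-mono (subsets n) dichotomy ⟩
        ∑ (subsets n) (λ A → (between? A₁ X A ▸ weight A) + (between? A₀ X₁ A ▸ weight A))
          ≡⟨ ∑-+ (subsets n) (λ A → between? A₁ X A ▸ weight A) (λ A → between? A₀ X₁ A ▸ weight A) ⟩
        ∑ (subsets n) (λ A → between? A₁ X A ▸ weight A) + ∑ (subsets n) (λ A → between? A₀ X₁ A ▸ weight A)
          -- The vertex u either joins the cluster or joins X, with probabilities 1/5 and 4/5; k,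
          -- the number of undecided vertices, drops by one in both branches.
          ≤⟨ +-mono-≤ (percolation k A₁ X (z , x∈p∪q⁺ (inj₁ z∈A₀)) near-A₁ size₁)
                      (percolation k A₀ X₁ (z , z∈A₀) near-X₁ size₂) ⟩
        4 ^ ∣ X ∣ * 5 ^ k + 4 ^ ∣ X₁ ∣ * 5 ^ k
          ≡⟨ cong (λ a → 4 ^ ∣ X ∣ * 5 ^ k + 4 ^ a * 5 ^ k) ∣X₁∣ ⟩
        4 ^ ∣ X ∣ * 5 ^ k + 4 ^ suc ∣ X ∣ * 5 ^ k
          ≡⟨ ring (4 ^ ∣ X ∣) (5 ^ k) ⟩
        4 ^ ∣ X ∣ * 5 ^ suc k ∎
        where
        ring : ∀ a b → a * b + 4 * a * b ≡ a * (5 * b)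
        ring = solve-∀
        ∣A₁∣ : ∣ A₁ ∣ ≡ suc ∣ A₀ ∣
        ∣A₁∣ = ∣p∪⁅x⁆∣≡1+∣p∣ A₀ u∉A₀
        ∣X₁∣ : ∣ X₁ ∣ ≡ suc ∣ X ∣
        ∣X₁∣ = ∣p∪⁅x⁆∣≡1+∣p∣ X u∉X
        size₁ : ∣ A₁ ∣ + ∣ X ∣ + k ≡ n
        size₁ = trans (cong (λ a → a + ∣ X ∣ + k) ∣A₁∣) (trans (sym (+-suc (∣ A₀ ∣ + ∣ X ∣) k)) size)
        size₂ : ∣ A₀ ∣ + ∣ X₁ ∣ + k ≡ n
        size₂ = trans (cong (λ a → ∣ A₀ ∣ + a + k) ∣X₁∣)
          (trans (cong (_+ k) (+-suc ∣ A₀ ∣ ∣ X ∣)) (trans (sym (+-suc (∣ A₀ ∣ + ∣ X ∣) k)) size))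

-- Kelly's lemma

-- A total map on vertices, unlike a bijection of `Elem` types, lets images of subsets be formed
-- without carrying membership proofs.
record IsIsoOn (G : Graph n) (S : Subset n) (G′ : Graph n) (T : Subset n) (φ : Fin n → Fin n) : Set where
  field
    maps      : ∀ {x} → x ∈ S → φ x ∈ T
    injective : ∀ {x y} → x ∈ S → y ∈ S → φ x ≡ φ y → x ≡ y
    onto      : ∀ {y} → y ∈ T → ∃ λ x → x ∈ S × φ x ≡ y
    preserves : ∀ {x y} → x ∈ S → y ∈ S → adj G x y ≡ adj G′ (φ x) (φ y)

-- Off S the extension is the identity, a value that is never used.
isoOn : ∀ {G G′ : Graph n} {S T} → InducedIso G S G′ T → ∃ (IsIsoOn G S G′ T)
isoOn {n} {G} {G′} {S} {T} (f , f-adj) = φ , record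
  { maps      = λ x∈S → subst (_∈ T) (sym (φ≡ x∈S)) (proj₂ (to (_ , x∈S)))
  ; injective = λ x∈S y∈S eq → cong proj₁ (injective (elem-≡ (trans (sym (φ≡ x∈S)) (trans eq (φ≡ y∈S)))))
  ; onto      = λ y∈T → let ((x , x∈S) , fx≡y) = strictlySurjective (_ , y∈T)
                        in x , x∈S , trans (φ≡ x∈S) (cong proj₁ fx≡y)
  ; preserves = λ x∈S y∈S → trans (f-adj (_ , x∈S) (_ , y∈S)) (sym (cong₂ (adj G′) (φ≡ x∈S) (φ≡ y∈S)))
  }
  where
  open Bijection f using (to; injective; strictlySurjective)
  elem-≡ : ∀ {S : Subset n} {x y : Elem S} → proj₁ x ≡ proj₁ y → x ≡ y
  elem-≡ {x = x , p} {y = .x , q} refl = cong (x ,_) ([]=-irrelevant p q)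
  extend : ∀ x → Dec (x ∈ S) → Fin n
  extend x (yes x∈S) = proj₁ (to (x , x∈S))
  extend x (no _)    = x
  φ : Fin n → Fin n
  φ x = extend x (x ∈? S)
  φ≡ : ∀ {x} (x∈S : x ∈ S) → φ x ≡ proj₁ (to (x , x∈S))
  φ≡ {x} x∈S = go (x ∈? S)
    where
    go : ∀ d → extend x d ≡ proj₁ (to (x , x∈S))
    go (yes p) = cong (λ q → proj₁ (to (x , q))) ([]=-irrelevant p x∈S)
    go (no ¬p) = contradiction x∈S ¬p

module Image {G G′ : Graph n} {S T : Subset n} {φ : Fin n → Fin n} (iso : IsIsoOn G S G′ T φ) where
  open IsIsoOn iso

  hit? : ∀ A y → Dec (∃ λ x → x ∈ A × φ x ≡ y)
  hit? A y = any? λ x → (x ∈? A) ×-dec (φ x Fin.≟ y)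

  image : Subset n → Subset n
  image A = comprehension (hit? A)

  ∈-image⁺ : ∀ {A x} → x ∈ A → φ x ∈ image A
  ∈-image⁺ {A} x∈A = ∈-comprehension⁺ (hit? A) (_ , x∈A , refl)

  ∈-image⁻ : ∀ {A y} → y ∈ image A → ∃ λ x → x ∈ A × φ x ≡ y
  ∈-image⁻ {A} = ∈-comprehension⁻ (hit? A)

  ∈-image-cancel : ∀ {A x} → A ⊆ S → x ∈ S → φ x ∈ image A → x ∈ A
  ∈-image-cancel {A} A⊆S x∈S φx∈ with x′ , x′∈A , eq ← ∈-image⁻ {A} φx∈ =
    subst (_∈ A) (injective (A⊆S x′∈A) x∈S eq) x′∈A

  image-⊆ : ∀ {A} → A ⊆ S → image A ⊆ T
  image-⊆ {A} A⊆S y∈ with _ , x∈A , refl ← ∈-image⁻ {A} y∈ = maps (A⊆S x∈A)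

  image-injective : ∀ {A B} → A ⊆ S → B ⊆ S → image A ≡ image B → A ≡ B
  image-injective A⊆S B⊆S eq = ⊆-antisym
    (λ x∈A → ∈-image-cancel B⊆S (A⊆S x∈A) (subst (_ ∈_) eq (∈-image⁺ x∈A)))
    (λ x∈B → ∈-image-cancel A⊆S (B⊆S x∈B) (subst (_ ∈_) (sym eq) (∈-image⁺ x∈B)))

  image-onto : image S ≡ T
  image-onto = ⊆-antisym (image-⊆ (λ x∈S → x∈S)) λ y∈T →
    let (x , x∈S , eq) = onto y∈T in subst (_∈ image S) eq (∈-image⁺ x∈S)

  ∣image∣ : ∀ {A} → A ⊆ S → ∣ image A ∣ ≡ ∣ A ∣
  ∣image∣ {A} A⊆S = ≤-antisym upper lower
    where
    open ≤-Reasoning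
    lower : ∣ A ∣ ≤ ∣ image A ∣
    lower = begin
      ∣ A ∣                                      ≡⟨ ∣p∣≡∑ A ⟩
      ∑ (allFin n) (λ v → (v ∈? A) ▸ 1)          ≤⟨ ∑-inject Fin._≟_ φ (allFin⁺ n)
          (λ v 0< → let v∈A = proj₁ (▸-positive (v ∈? A) 0<) in ∈-allFin (φ v) ,
             ▸-mono (v ∈? A) (φ v ∈? image A) ∈-image⁺ (λ _ → ≤-refl))
          (λ {x} {y} 0<x 0<y → injective (A⊆S (proj₁ (▸-positive (x ∈? A) 0<x))) (A⊆S (proj₁ (▸-positive (y ∈? A) 0<y)))) ⟩
      ∑ (allFin n) (λ v → (v ∈? image A) ▸ 1)    ≡⟨ ∣p∣≡∑ (image A) ⟨
      ∣ image A ∣                                ∎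
    upper : ∣ image A ∣ ≤ ∣ A ∣
    upper = begin
      ∣ image A ∣
        ≡⟨ ∣p∣≡∑ (image A) ⟩
      ∑ (allFin n) (λ y → (y ∈? image A) ▸ 1)
        ≤⟨ ∑-mono (allFin n) (λ y → ▸-bound (y ∈? image A) λ y∈ → let (x , x∈A , eq) = ∈-image⁻ {A} y∈ in
             ≤-trans (≤-reflexive (sym (▸-yes ((x ∈? A) ×-dec (φ x Fin.≟ y)) (x∈A , eq))))
                     (∑-member (λ x → ((x ∈? A) ×-dec (φ x Fin.≟ y)) ▸ 1) (∈-allFin x))) ⟩
      ∑ (allFin n) (λ y → ∑ (allFin n) (λ x → ((x ∈? A) ×-dec (φ x Fin.≟ y)) ▸ 1))
        ≡⟨ ∑-swap (allFin n) (allFin n) _ ⟩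
      ∑ (allFin n) (λ x → ∑ (allFin n) (λ y → ((x ∈? A) ×-dec (φ x Fin.≟ y)) ▸ 1))
        ≤⟨ ∑-mono (allFin n) (λ x → per (x ∈? A)) ⟩
      ∑ (allFin n) (λ x → (x ∈? A) ▸ 1)
        ≡⟨ ∣p∣≡∑ A ⟨
      ∣ A ∣ ∎
      where
      per : ∀ {x} (d : Dec (x ∈ A)) → ∑ (allFin n) (λ y → (d ×-dec (φ x Fin.≟ y)) ▸ 1) ≤ d ▸ 1
      per {x} (yes x∈A) = ∑-at-most-one (λ y → yes x∈A ×-dec (φ x Fin.≟ y)) 1 (allFin⁺ n)
                        (λ (_ , p) (_ , q) → trans (sym p) q)
      per {x} (no x∉A)  = ≤-reflexive (∑-zero (allFin n) (λ y → refl))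

  -- A split of the image pulls back to a split of A.
  image-unsplittable : ∀ {A} → A ⊆ S → Unsplittable G A → Unsplittable G′ (image A)
  image-unsplittable {A} A⊆S unsplittable (U′ , U′⊆ , (y , y∈U′) , (z , z∈ , z∉U′) , uncrossed) =
    unsplittable (U , U⊆A , nonempty , proper , λ u v u∈U v∈A v∉U →
      trans (preserves (A⊆S (U⊆A u∈U)) (A⊆S v∈A))
            (uncrossed (φ u) (φ v) (proj₂ (∈-comprehension⁻ pre? u∈U)) (∈-image⁺ v∈A)
                       (λ φv∈U′ → v∉U (∈-comprehension⁺ pre? (v∈A , φv∈U′)))))
    where
    pre? : ∀ x → Dec (x ∈ A × φ x ∈ U′)
    pre? x = (x ∈? A) ×-dec (φ x ∈? U′)
    U : Subset n
    U = comprehension pre?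
    U⊆A : U ⊆ A
    U⊆A x∈U = proj₁ (∈-comprehension⁻ pre? x∈U)
    nonempty : Nonempty U
    nonempty = let (x , x∈A , eq) = ∈-image⁻ {A} (U′⊆ y∈U′)
               in x , ∈-comprehension⁺ pre? (x∈A , subst (_∈ U′) (sym eq) y∈U′)
    proper : ∃ λ v → v ∈ A × v ∉ U
    proper = let (x , x∈A , eq) = ∈-image⁻ {A} z∈
             in x , x∈A , λ x∈U → z∉U′ (subst (_∈ U′) eq (proj₂ (∈-comprehension⁻ pre? x∈U)))

  image-far : ∀ {A B} → A ⊆ S → B ⊆ S → B ⊆ far G A → image B ⊆ far G′ (image A)
  image-far {A} {B} A⊆S B⊆S B⊆far y∈ with b , b∈B , refl ← ∈-image⁻ {B} y∈
    with b∉A , untouched ← ∈-comprehension⁻ (far? G A) (B⊆far b∈B) =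
    ∈-comprehension⁺ (far? G′ (image A)) ((λ φb∈ → b∉A (∈-image-cancel A⊆S (B⊆S b∈B) φb∈)) , touching)
    where
    touching : ¬ Touches G′ (image A) (φ b)
    touching (_ , x∈ , edge) with a , a∈A , refl ← ∈-image⁻ {A} x∈ =
      untouched (a , a∈A , trans (preserves (A⊆S a∈A) (B⊆S b∈B)) edge)

InducedIso-sym : ∀ {G G′ : Graph n} {S T} → InducedIso G S G′ T → InducedIso G′ T G S
InducedIso-sym {G′ = G′} (f , f-adj) = ⤖-sym f , λ x y →
  trans (sym (cong₂ (λ a b → adj G′ (proj₁ a) (proj₁ b)) (to∘to⁻ f x) (to∘to⁻ f y)))
        (sym (f-adj _ _))
  where
  to∘to⁻ : ∀ {A B : Set} (f : A ⤖ B) y → Bijection.to f (Bijection.to (⤖-sym f) y) ≡ y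
  to∘to⁻ f y = proj₂ (Bijection.strictlySurjective f y)

SameDeck-sym : ∀ {ℓ} {G G′ : Graph n} → SameDeck ℓ G G′ → SameDeck ℓ G′ G
SameDeck-sym {ℓ = ℓ} {G} {G′} (σ , isos) = ⤖-sym σ , λ T →
  InducedIso-sym {G = G} {G′ = G′} (subst (λ T′ → InducedIso G (proj₁ (Bijection.to (⤖-sym σ) T)) G′ (proj₁ T′))
    (proj₂ (Bijection.strictlySurjective σ T)) (isos (Bijection.to (⤖-sym σ) T)))

▸-× : ∀ (P? : Dec P) (Q? : Dec Q) k → (P? ×-dec Q?) ▸ k ≡ P? ▸ (Q? ▸ k)
▸-× (yes _) Q? k = refl
▸-× (no _)  Q? k = refl

module _ (G : Graph n) where

  connected? : ∀ h A → Dec (∣ A ∣ ≡ h × Unsplittable G A)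
  connected? h A = (∣ A ∣ ≟ h) ×-dec unsplittable? G A

  apart? : ∀ j A B → Dec (∣ B ∣ ≡ j × B ⊆ far G A)
  apart? j A B = (∣ B ∣ ≟ j) ×-dec (B ⊆? far G A)

  -- Nonadjacency of A and B is visible in any card containing both, whereas the number of
  -- neighbours of A in the whole graph is not. Hence c(A) is what the deck gives access to.
  apartWithin : ℕ → Subset n → Subset n → ℕ
  apartWithin j A S = ∑ (subsets n) λ B → (apart? j A B ×-dec (B ⊆? S)) ▸ 1

  pairsWithin : ℕ → ℕ → Subset n → ℕ
  pairsWithin h j S = ∑ (subsets n) λ A → (connected? h A ×-dec (A ⊆? S)) ▸ apartWithin j A S

  deckPairs : ℕ → ℕ → ℕ → ℕ
  deckPairs ℓ h j = ∑ (subsets n) λ S → (∣ S ∣ ≟ ℓ) ▸ pairsWithin h j S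

  apartCount : ∀ j A → ∑ (subsets n) (λ B → apart? j A B ▸ 1) ≡ ∣ far G A ∣ C j
  apartCount j A = ∑-subsets-of-size (far G A) j

  -- Triples (A, B, S) are counted by the pair (A, B) first: A and B are disjoint with h + j
  -- vertices together, so C(n - h - j, m) sets S of h + j + m vertices contain both.
  kelly : ∀ h j m → deckPairs (h + j + m) h j ≡
    ((n ∸ (h + j)) C m) * ∑ (subsets n) (λ A → connected? h A ▸ (∣ far G A ∣ C j))
  kelly h j m = begin
    ∑ ss (λ S → (∣ S ∣ ≟ ℓ) ▸ ∑ ss (λ A → (connected? h A ×-dec (A ⊆? S)) ▸
      ∑ ss (λ B → (apart? j A B ×-dec (B ⊆? S)) ▸ 1)))
      ≡⟨ ∑-cong ss (λ S → trans
          (▸-cong (∣ S ∣ ≟ ℓ) (λ _ → ∑-cong ss (λ A → ▸-∑ (connected? h A ×-dec (A ⊆? S)) ss _)))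
          (trans (▸-∑ (∣ S ∣ ≟ ℓ) ss _) (∑-cong ss (λ A → ▸-∑ (∣ S ∣ ≟ ℓ) ss _)))) ⟩
    ∑ ss (λ S → ∑ ss (λ A → ∑ ss (λ B → inCard A B S)))
      ≡⟨ ∑-swap ss ss _ ⟩
    ∑ ss (λ A → ∑ ss (λ S → ∑ ss (λ B → inCard A B S)))
      ≡⟨ ∑-cong ss (λ A → ∑-swap ss ss _) ⟩
    ∑ ss (λ A → ∑ ss (λ B → ∑ ss (λ S → inCard A B S)))
      ≡⟨ ∑-cong ss (λ A → ∑-cong ss (λ B → cards A B)) ⟩
    ∑ ss (λ A → ∑ ss (λ B → K * (connected? h A ▸ apart? j A B ▸ 1)))
      ≡⟨ ∑-cong ss (λ A → trans (∑-*ˡ ss K _) (cong (K *_) (trans (sym (▸-∑ (connected? h A) ss _))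
           (▸-cong (connected? h A) (λ _ → apartCount j A))))) ⟩
    ∑ ss (λ A → K * (connected? h A ▸ (∣ far G A ∣ C j)))
      ≡⟨ ∑-*ˡ ss K _ ⟩
    K * ∑ ss (λ A → connected? h A ▸ (∣ far G A ∣ C j)) ∎
    where
    open ≡-Reasoning
    ss = subsets n
    ℓ = h + j + m
    K = (n ∸ (h + j)) C m
    inCard : Subset n → Subset n → Subset n → ℕ
    inCard A B S = (∣ S ∣ ≟ ℓ) ▸ (connected? h A ×-dec (A ⊆? S)) ▸ (apart? j A B ×-dec (B ⊆? S)) ▸ 1
    supersets : ∀ A B → ∣ A ∣ ≡ h × Unsplittable G A → ∣ B ∣ ≡ j × B ⊆ far G A →
      ∑ ss (λ S → ((∣ S ∣ ≟ ℓ) ×-dec ((A ∪ B) ⊆? S)) ▸ 1) ≡ K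
    supersets A B (refl , _) (refl , B⊆far) = subst
      (λ t → ∑ ss (λ S → ((∣ S ∣ ≟ t + m) ×-dec ((A ∪ B) ⊆? S)) ▸ 1) ≡ (n ∸ t) C m)
      (∣p∪q∣≡∣p∣+∣q∣ A B (λ x∈A x∈B → proj₁ (∈-comprehension⁻ (far? G A) (B⊆far x∈B)) x∈A))
      (trans (∑-supersets-of-size (A ∪ B) m) (cong (_C m) (∣∁p∣≡n∸∣p∣ (A ∪ B))))
    cards : ∀ A B → ∑ ss (λ S → inCard A B S)
                  ≡ K * (connected? h A ▸ apart? j A B ▸ 1)
    cards A B = begin
      ∑ ss (λ S → inCard A B S)
        ≡⟨ ∑-cong ss rearrange ⟩
      ∑ ss (λ S → (connected? h A ×-dec apart? j A B) ▸ ((∣ S ∣ ≟ ℓ) ×-dec ((A ∪ B) ⊆? S)) ▸ 1)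
        ≡⟨ ▸-∑ (connected? h A ×-dec apart? j A B) ss _ ⟨
      (connected? h A ×-dec apart? j A B) ▸ ∑ ss (λ S → ((∣ S ∣ ≟ ℓ) ×-dec ((A ∪ B) ⊆? S)) ▸ 1)
        ≡⟨ ▸-cong (connected? h A ×-dec apart? j A B) (λ (a , b) → trans (supersets A B a b) (sym (*-identityʳ K))) ⟩
      (connected? h A ×-dec apart? j A B) ▸ K * 1
        ≡⟨ ▸-*ˡ (connected? h A ×-dec apart? j A B) K 1 ⟩
      K * ((connected? h A ×-dec apart? j A B) ▸ 1)
        ≡⟨ cong (K *_) (▸-× (connected? h A) (apart? j A B) 1) ⟩
      K * (connected? h A ▸ apart? j A B ▸ 1) ∎
      where
      rearrange : ∀ S → inCard A B S
                      ≡ (connected? h A ×-dec apart? j A B) ▸ ((∣ S ∣ ≟ ℓ) ×-dec ((A ∪ B) ⊆? S)) ▸ 1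
      rearrange S = begin
        inCard A B S
          ≡⟨ cong ((∣ S ∣ ≟ ℓ) ▸_) (▸-× (connected? h A ×-dec (A ⊆? S)) (apart? j A B ×-dec (B ⊆? S)) 1) ⟨
        (∣ S ∣ ≟ ℓ) ▸ ((connected? h A ×-dec (A ⊆? S)) ×-dec (apart? j A B ×-dec (B ⊆? S))) ▸ 1
          ≡⟨ ▸-× (∣ S ∣ ≟ ℓ) ((connected? h A ×-dec (A ⊆? S)) ×-dec (apart? j A B ×-dec (B ⊆? S))) 1 ⟨
        ((∣ S ∣ ≟ ℓ) ×-dec ((connected? h A ×-dec (A ⊆? S)) ×-dec (apart? j A B ×-dec (B ⊆? S)))) ▸ 1
          ≡⟨ ▸-iff ((∣ S ∣ ≟ ℓ) ×-dec ((connected? h A ×-dec (A ⊆? S)) ×-dec (apart? j A B ×-dec (B ⊆? S))))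
                   ((connected? h A ×-dec apart? j A B) ×-dec ((∣ S ∣ ≟ ℓ) ×-dec ((A ∪ B) ⊆? S)))
                   (λ (s , (c , i) , (a , i′)) → (c , a) , s , λ x∈ → [ i , i′ ]′ (x∈p∪q⁻ A B x∈))
                   (λ ((c , a) , s , u) → s , (c , λ x∈ → u (p⊆p∪q B x∈)) , (a , λ x∈ → u (q⊆p∪q A B x∈))) ⟩
        ((connected? h A ×-dec apart? j A B) ×-dec ((∣ S ∣ ≟ ℓ) ×-dec ((A ∪ B) ⊆? S))) ▸ 1
          ≡⟨ ▸-× (connected? h A ×-dec apart? j A B) ((∣ S ∣ ≟ ℓ) ×-dec ((A ∪ B) ⊆? S)) 1 ⟩
        (connected? h A ×-dec apart? j A B) ▸ ((∣ S ∣ ≟ ℓ) ×-dec ((A ∪ B) ⊆? S)) ▸ 1 ∎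

module _ {G G′ : Graph n} {S T : Subset n} {φ : Fin n → Fin n} (iso : IsIsoOn G S G′ T φ) where
  open Image iso

  apartWithin-≤ : ∀ j {A} → A ⊆ S → apartWithin G j A S ≤ apartWithin G′ j (image A) T
  apartWithin-≤ j {A} A⊆S = ∑-inject _≟ₛ_ image (subsets-unique n)
    (λ B 0< → ∈-subsets (image B) ,
      ▸-mono (apart? G j A B ×-dec (B ⊆? S)) (apart? G′ j (image A) (image B) ×-dec (image B ⊆? T))
      (λ ((∣B∣ , B⊆far) , B⊆S) → (trans (∣image∣ B⊆S) ∣B∣ , image-far A⊆S B⊆S B⊆far) , image-⊆ B⊆S) (λ _ → ≤-refl))
    (λ {B} {B′} 0<B 0<B′ → image-injective (within B 0<B) (within B′ 0<B′))
    where
    within : ∀ B → 0 < (apart? G j A B ×-dec (B ⊆? S)) ▸ 1 → B ⊆ S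
    within B 0< = proj₂ (proj₁ (▸-positive (apart? G j A B ×-dec (B ⊆? S)) 0<))

  pairsWithin-≤ : ∀ h j → pairsWithin G h j S ≤ pairsWithin G′ h j T
  pairsWithin-≤ h j = ∑-inject _≟ₛ_ image (subsets-unique n)
    (λ A 0< → ∈-subsets (image A) ,
      ▸-mono (connected? G h A ×-dec (A ⊆? S)) (connected? G′ h (image A) ×-dec (image A ⊆? T))
      (λ ((∣A∣ , c) , A⊆S) → (trans (∣image∣ A⊆S) ∣A∣ , image-unsplittable A⊆S c) , image-⊆ A⊆S)
      (λ (_ , A⊆S) → apartWithin-≤ j A⊆S))
    (λ {A} {A′} 0<A 0<A′ → image-injective (within A 0<A) (within A′ 0<A′))
    where
    within : ∀ A → 0 < (connected? G h A ×-dec (A ⊆? S)) ▸ apartWithin G j A S → A ⊆ S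
    within A 0< = proj₂ (proj₁ (▸-positive (connected? G h A ×-dec (A ⊆? S)) 0<))

-- Images under the card isomorphisms inject the pairs of each card into those of its partner. One
-- inequality suffices, since the reverse one is the same statement for `SameDeck-sym`.
deckPairs-≤ : ∀ {G G′ : Graph n} {ℓ} → SameDeck ℓ G G′ → ∀ h j → deckPairs G ℓ h j ≤ deckPairs G′ ℓ h j
deckPairs-≤ {n} {G} {G′} {ℓ} (σ , isos) h j = ∑-inject _≟ₛ_ τ (subsets-unique n)
  (λ S 0< → ∈-subsets (τ S) , ▸-bound (∣ S ∣ ≟ ℓ) λ ∣S∣ → matched S ∣S∣)
  (λ {S} {S′} 0<S 0<S′ eq →
    let p = proj₁ (▸-positive (∣ S ∣ ≟ ℓ) 0<S)
        q = proj₁ (▸-positive (∣ S′ ∣ ≟ ℓ) 0<S′)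
    in cong proj₁ (Bijection.injective σ (card-≡ (trans (sym (τ≡ p)) (trans eq (τ≡ q))))))
  where
  card-≡ : ∀ {S T : Subsetℓ n ℓ} → proj₁ S ≡ proj₁ T → S ≡ T
  card-≡ {S , p} {.S , q} refl = cong (S ,_) (≡-irrelevant p q)
  extend : ∀ S → Dec (∣ S ∣ ≡ ℓ) → Subset n
  extend S (yes p) = proj₁ (Bijection.to σ (S , p))
  -- An arbitrary value: the summand is 0 at sets of other sizes.
  extend S (no _)  = S
  τ : Subset n → Subset n
  τ S = extend S (∣ S ∣ ≟ ℓ)
  τ≡ : ∀ {S} (p : ∣ S ∣ ≡ ℓ) → τ S ≡ proj₁ (Bijection.to σ (S , p))
  τ≡ {S} p = go (∣ S ∣ ≟ ℓ)
    where
    go : ∀ d → extend S d ≡ proj₁ (Bijection.to σ (S , p))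
    go (yes q) = cong (λ r → proj₁ (Bijection.to σ (S , r))) (≡-irrelevant q p)
    go (no ¬p) = contradiction p ¬p
  matched : ∀ S → ∣ S ∣ ≡ ℓ → pairsWithin G h j S ≤ (∣ τ S ∣ ≟ ℓ) ▸ pairsWithin G′ h j (τ S)
  matched S p = subst (λ T → pairsWithin G h j S ≤ (∣ T ∣ ≟ ℓ) ▸ pairsWithin G′ h j T) (sym (τ≡ p))
    (≤-trans (pairsWithin-≤ (proj₂ (isoOn {G = G} {G′} (isos (S , p)))) h j)
             (≤-reflexive (sym (▸-yes (∣ proj₁ (Bijection.to σ (S , p)) ∣ ≟ ℓ) (proj₂ (Bijection.to σ (S , p)))))))

far-moments : ∀ {G G′ : Graph n} {ℓ} → SameDeck ℓ G G′ → ℓ ≤ n → ∀ h j → h + j ≤ ℓ →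
  ∑ (subsets n) (λ A → connected? G h A ▸ (∣ far G A ∣ C j)) ≡ ∑ (subsets n) (λ A → connected? G′ h A ▸ (∣ far G′ A ∣ C j))
far-moments {n} {G} {G′} {ℓ} same ℓ≤n h j h+j≤ℓ = *-cancelˡ-≡ _ _ K {{>-nonZero K>0}} (begin
  K * ∑ (subsets n) (λ A → connected? G h A ▸ (∣ far G A ∣ C j))   ≡⟨ kelly G h j m ⟨
  deckPairs G (h + j + m) h j                                     ≡⟨ cong (λ t → deckPairs G t h j) split ⟩
  deckPairs G ℓ h j
    ≡⟨ ≤-antisym (deckPairs-≤ {G = G} {G′} same h j) (deckPairs-≤ {G = G′} {G} (SameDeck-sym {G = G} {G′ = G′} same) h j) ⟩
  deckPairs G′ ℓ h j                                              ≡⟨ cong (λ t → deckPairs G′ t h j) split ⟨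
  deckPairs G′ (h + j + m) h j                                    ≡⟨ kelly G′ h j m ⟩
  K * ∑ (subsets n) (λ A → connected? G′ h A ▸ (∣ far G′ A ∣ C j)) ∎)
  where
  open ≡-Reasoning
  m = ℓ ∸ (h + j)
  K = (n ∸ (h + j)) C m
  split : h + j + m ≡ ℓ
  split = m+[n∸m]≡n h+j≤ℓ
  K>0 : 0 < K
  K>0 = nCk>0 (∸-monoˡ-≤ (h + j) ℓ≤n)

-- Moments of the degree distribution of connected sets

module _ (h : ℕ) where

  total : Graph n → (ℕ → ℕ → ℕ) → ℕ
  total {n} G f = ∑ (subsets n) λ A → connected? G h A ▸ f ∣ near G A ∣ ∣ far G A ∣

  module _ {N : ℕ} (h+N≡n : h + N ≡ n) (G : Graph n) where

    near+far : ∀ {A} → ∣ A ∣ ≡ h → ∣ near G A ∣ + ∣ far G A ∣ ≡ N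
    near+far {A} refl = +-cancelˡ-≡ ∣ A ∣ _ _
      (trans (sym (+-assoc ∣ A ∣ _ _)) (trans (∣A∣+∣near∣+∣far∣≡n G A) (sym h+N≡n)))

    total-mono : ∀ {f f′} → (∀ d c → d + c ≡ N → f d c ≤ f′ d c) → total G f ≤ total G f′
    total-mono f≤ = ∑-mono (subsets n) λ A → ▸-mono (connected? G h A) (connected? G h A) (λ p → p)
      λ (∣A∣ , _) → f≤ _ _ (near+far ∣A∣)

    total-cong : ∀ {f f′} → (∀ d c → d + c ≡ N → f d c ≡ f′ d c) → total G f ≡ total G f′
    total-cong f≡ = ≤-antisym (total-mono λ d c e → ≤-reflexive (f≡ d c e))
                              (total-mono λ d c e → ≤-reflexive (sym (f≡ d c e)))

  total-+ : ∀ (G : Graph n) f f′ → total G (λ d c → f d c + f′ d c) ≡ total G f + total G f′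
  total-+ {n} G f f′ = trans (∑-cong (subsets n) λ A → ▸-+ (connected? G h A) _ _) (∑-+ (subsets n) _ _)

  total-*ˡ : ∀ (G : Graph n) k f → total G (λ d c → k * f d c) ≡ k * total G f
  total-*ˡ {n} G k f = trans (∑-cong (subsets n) λ A → ▸-*ˡ (connected? G h A) k _) (∑-*ˡ (subsets n) k _)

  moment : Graph n → ℕ → ℕ → ℕ
  moment G j i = total G λ d c → (c C j) * (d C i)

  -- Multiply C(c, j) C(d, i) by d + c = N and expand d C(d, i) and c C(c, j) by `C-absorb`.
  moment-recurrence : ∀ {N} → h + N ≡ n → (G : Graph n) → ∀ j i →
    suc i * moment G j (suc i) + (suc j * moment G (suc j) i + (i + j) * moment G j i) ≡ N * moment G j i
  moment-recurrence {N = N} h+N≡n G j i = begin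
    suc i * moment G j (suc i) + (suc j * moment G (suc j) i + (i + j) * moment G j i)
      ≡⟨ cong₂ _+_ (total-*ˡ G (suc i) (g j (suc i))) (cong₂ _+_ (total-*ˡ G (suc j) (g (suc j) i)) (total-*ˡ G (i + j) (g j i))) ⟨
    total G f₁ + (total G f₂ + total G f₃)
      ≡⟨ trans (total-+ G f₁ (λ d c → f₂ d c + f₃ d c)) (cong (total G f₁ +_) (total-+ G f₂ f₃)) ⟨
    total G (λ d c → f₁ d c + (f₂ d c + f₃ d c))
      ≡⟨ total-cong h+N≡n G pointwise ⟩
    total G (λ d c → N * ((c C j) * (d C i)))
      ≡⟨ total-*ˡ G N (g j i) ⟩
    N * moment G j i ∎
    where
    open ≡-Reasoning
    g : ℕ → ℕ → ℕ → ℕ → ℕ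
    g j i d c = (c C j) * (d C i)
    f₁ f₂ f₃ : ℕ → ℕ → ℕ
    f₁ d c = suc i * ((c C j) * (d C suc i))
    f₂ d c = suc j * ((c C suc j) * (d C i))
    f₃ d c = (i + j) * ((c C j) * (d C i))
    expand : ∀ i j x x′ y y′ → suc i * (x * y′) + (suc j * (x′ * y) + (i + j) * (x * y))
           ≡ x * (suc i * y′ + i * y) + (suc j * x′ + j * x) * y
    expand = solve-∀
    collect : ∀ c d x y → x * (d * y) + (c * x) * y ≡ (d + c) * (x * y)
    collect = solve-∀
    pointwise : ∀ d c → d + c ≡ N → f₁ d c + (f₂ d c + f₃ d c) ≡ N * ((c C j) * (d C i))
    pointwise d c refl = begin
      f₁ d c + (f₂ d c + f₃ d c)
        ≡⟨ expand i j (c C j) (c C suc j) (d C i) (d C suc i) ⟩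
      (c C j) * (suc i * (d C suc i) + i * (d C i)) + (suc j * (c C suc j) + j * (c C j)) * (d C i)
        ≡⟨ cong₂ (λ u v → (c C j) * u + v * (d C i)) (C-absorb d i) (C-absorb c j) ⟩
      (c C j) * (d * (d C i)) + (c * (c C j)) * (d C i)
        ≡⟨ collect c d (c C j) (d C i) ⟩
      (d + c) * ((c C j) * (d C i)) ∎

  module _ {N ℓ : ℕ} (h+N≡n : h + N ≡ n) {G G′ : Graph n} (same : SameDeck ℓ G G′) (ℓ≤n : ℓ ≤ n) where

    -- Induction on i: the case i = 0 is Kelly's lemma, and the recurrence expresses the moment (j,
    -- i + 1) by (j + 1, i) and (j, i), whose degrees are no larger.
    moments-agree : ∀ i j → h + (j + i) ≤ ℓ → moment G j i ≡ moment G′ j i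
    moments-agree zero    j ≤ℓ = begin
      moment G j 0                    ≡⟨ total-cong h+N≡n G (λ d c _ → *-identityʳ (c C j)) ⟩
      total G (λ d c → c C j)         ≡⟨ far-moments {G = G} {G′} same ℓ≤n h j (subst (λ k → h + k ≤ ℓ) (+-identityʳ j) ≤ℓ) ⟩
      total G′ (λ d c → c C j)        ≡⟨ total-cong h+N≡n G′ (λ d c _ → *-identityʳ (c C j)) ⟨
      moment G′ j 0                   ∎
      where open ≡-Reasoning
    moments-agree (suc i) j ≤ℓ = *-cancelˡ-≡ _ _ (suc i) (+-cancelʳ-≡ (suc j * moment G (suc j) i + (i + j) * moment G j i) _ _ (begin
      suc i * moment G j (suc i) + (suc j * moment G (suc j) i + (i + j) * moment G j i)
        ≡⟨ moment-recurrence h+N≡n G j i ⟩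
      N * moment G j i
        ≡⟨ cong (N *_) lower ⟩
      N * moment G′ j i
        ≡⟨ moment-recurrence h+N≡n G′ j i ⟨
      suc i * moment G′ j (suc i) + (suc j * moment G′ (suc j) i + (i + j) * moment G′ j i)
        ≡⟨ cong₂ (λ u v → suc i * moment G′ j (suc i) + (suc j * u + (i + j) * v)) raised lower ⟨
      suc i * moment G′ j (suc i) + (suc j * moment G (suc j) i + (i + j) * moment G j i) ∎))
      where
      open ≡-Reasoning
      raised : moment G (suc j) i ≡ moment G′ (suc j) i
      raised = moments-agree i (suc j) (subst (λ k → h + k ≤ ℓ) (+-suc j i) ≤ℓ)
      lower : moment G j i ≡ moment G′ j i
      lower = moments-agree i j (≤-trans (+-monoʳ-≤ h (+-monoʳ-≤ j (n≤1+n i))) ≤ℓ)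

  -- The value of C(d − 1, a) at d ≥ 1, and 0 at d = 0.
  predC : ℕ → ℕ → ℕ
  predC zero    a = 0
  predC (suc d) a = d C a

  -- For a = 3r this is the sum of p(d(A)) over d(A) ≥ 1. The terms with d(A) = 0 are kept apart in
  -- `closedPart`, where the polynomial C(d - 1, a) has the value 1 or -1 and only C(c, M) is
  -- recorded.
  tail : Graph n → ℕ → ℕ → ℕ
  tail G M a = total G λ d c → (c C M) * predC d a

  closedPart : Graph n → ℕ → ℕ
  closedPart G M = total G λ d c → (d ≟ 0) ▸ (c C M)

  tail-zero : ∀ {N} → h + N ≡ n → (G : Graph n) → ∀ M → tail G M 0 + closedPart G M ≡ moment G M 0
  tail-zero h+N≡n G M = trans (sym (total-+ G (λ d c → (c C M) * predC d 0) (λ d c → (d ≟ 0) ▸ (c C M))))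
                              (total-cong h+N≡n G pointwise)
    where
    pointwise : ∀ d c → d + c ≡ _ → (c C M) * predC d 0 + ((d ≟ 0) ▸ (c C M)) ≡ (c C M) * (d C 0)
    pointwise zero    c _ = trans (cong (_+ (c C M)) (*-zeroʳ (c C M))) (sym (*-identityʳ _))
    pointwise (suc d) c _ = +-identityʳ _

  -- Pascal's rule for d ≥ 1. At d = 0 both sides vanish because C(0, a + 1) = 0; in `tail-zero` the
  -- value C(0, 0) = 1 brings in `closedPart` instead.
  tail-suc : ∀ {N} → h + N ≡ n → (G : Graph n) → ∀ M a → tail G M a + tail G M (suc a) ≡ moment G M (suc a)
  tail-suc h+N≡n G M a = trans (sym (total-+ G (λ d c → (c C M) * predC d a) (λ d c → (c C M) * predC d (suc a)))) (total-cong h+N≡n G pointwise)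
    where
    pointwise : ∀ d c → d + c ≡ _ → (c C M) * predC d a + (c C M) * predC d (suc a) ≡ (c C M) * (d C suc a)
    pointwise zero    c _ = trans (cong₂ _+_ (*-zeroʳ (c C M)) (*-zeroʳ (c C M))) (sym (*-zeroʳ (c C M)))
    pointwise (suc d) c _ = trans (sym (*-distribˡ-+ (c C M) (d C a) (d C suc a)))
                                  (cong ((c C M) *_) (nCk+nC[k+1]≡[n+1]C[k+1] d a))

  -- Evaluating C(d − 1, a) = Σ_{i ≤ a} (−1)^(a − i) C(d, i) at d = 0 gives (−1)^a, whence the alternation.
  tails-alternate : ∀ {N ℓ} → h + N ≡ n → {G G′ : Graph n} → SameDeck ℓ G G′ → ℓ ≤ n → ∀ M →
    closedPart G M ≡ 0 → ∀ a → h + (M + a) ≤ ℓ →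
    (tail G M a ≡ tail G′ M a + closedPart G′ M) ⊎ (tail G′ M a ≡ tail G M a + closedPart G′ M)
  tails-alternate h+N≡n {G} {G′} same ℓ≤n M none zero ≤ℓ = inj₁ (begin
    tail G M 0                        ≡⟨ +-identityʳ _ ⟨
    tail G M 0 + 0                    ≡⟨ cong (tail G M 0 +_) none ⟨
    tail G M 0 + closedPart G M       ≡⟨ tail-zero h+N≡n G M ⟩
    moment G M 0                      ≡⟨ moments-agree h+N≡n {G} {G′} same ℓ≤n 0 M ≤ℓ ⟩
    moment G′ M 0                     ≡⟨ tail-zero h+N≡n G′ M ⟨
    tail G′ M 0 + closedPart G′ M     ∎)
    where open ≡-Reasoning
  tails-alternate h+N≡n {G} {G′} same ℓ≤n M none (suc a) ≤ℓ =
    -- Two consecutive tails have the same sum in both graphs, so a surplus of one graph at a is a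
    -- surplus of the other at a + 1.
    [ inj₂ ∘ flip-left , inj₁ ∘ flip-right ]′
      (tails-alternate h+N≡n {G} {G′} same ℓ≤n M none a
        (≤-trans (+-monoʳ-≤ h (+-monoʳ-≤ M (n≤1+n a))) ≤ℓ))
    where
    open ≡-Reasoning
    z = closedPart G′ M
    agree : tail G M a + tail G M (suc a) ≡ tail G′ M a + tail G′ M (suc a)
    agree = trans (tail-suc h+N≡n G M a)
      (trans (moments-agree h+N≡n {G} {G′} same ℓ≤n (suc a) M ≤ℓ) (sym (tail-suc h+N≡n G′ M a)))
    ring : ∀ x y z → x + z + y ≡ x + (y + z)
    ring = solve-∀
    flip-left : tail G M a ≡ tail G′ M a + z → tail G′ M (suc a) ≡ tail G M (suc a) + z
    flip-left e = +-cancelˡ-≡ (tail G′ M a) _ _ (begin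
      tail G′ M a + tail G′ M (suc a)     ≡⟨ agree ⟨
      tail G M a + tail G M (suc a)       ≡⟨ cong (_+ tail G M (suc a)) e ⟩
      tail G′ M a + z + tail G M (suc a)  ≡⟨ ring (tail G′ M a) (tail G M (suc a)) z ⟩
      tail G′ M a + (tail G M (suc a) + z) ∎)
    flip-right : tail G′ M a ≡ tail G M a + z → tail G M (suc a) ≡ tail G′ M (suc a) + z
    flip-right e = +-cancelˡ-≡ (tail G M a) _ _ (begin
      tail G M a + tail G M (suc a)        ≡⟨ agree ⟩
      tail G′ M a + tail G′ M (suc a)      ≡⟨ cong (_+ tail G′ M (suc a)) e ⟩
      tail G M a + z + tail G′ M (suc a)   ≡⟨ ring (tail G M a) (tail G′ M (suc a)) z ⟩
      tail G M a + (tail G′ M (suc a) + z) ∎)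

-- Percolation bound on the tails

weight-bound : ∀ h (G : Graph n) → h * total h G (λ d c → 4 ^ d * 5 ^ c) ≤ n * 5 ^ pred n
weight-bound {n} h G = begin
  h * total h G (λ d c → 4 ^ d * 5 ^ c)
    ≡⟨ ∑-*ˡ (subsets n) h _ ⟨
  ∑ (subsets n) (λ A → h * (connected? G h A ▸ weight G A))
    ≤⟨ ∑-mono (subsets n) rooted ⟩
  ∑ (subsets n) (λ A → ∑ (allFin n) (λ v → (v ∈? A) ▸ connected? G h A ▸ weight G A))
    ≡⟨ ∑-swap (subsets n) (allFin n) _ ⟩
  ∑ (allFin n) (λ v → ∑ (subsets n) (λ A → (v ∈? A) ▸ connected? G h A ▸ weight G A))
    ≤⟨ ∑-mono (allFin n) at ⟩
  ∑ (allFin n) (λ _ → 5 ^ pred n)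
    ≡⟨ trans (∑-const (allFin n) _) (cong (_* 5 ^ pred n) (length-tabulate {n = n} (λ z → z))) ⟩
  n * 5 ^ pred n ∎
  where
  open ≤-Reasoning
  rooted : ∀ A → h * (connected? G h A ▸ weight G A) ≤
    ∑ (allFin n) (λ v → (v ∈? A) ▸ connected? G h A ▸ weight G A)
  rooted A = subst (_≤ ∑ (allFin n) (λ v → (v ∈? A) ▸ connected? G h A ▸ weight G A)) (▸-*ˡ (connected? G h A) h _)
    (▸-bound (connected? G h A) λ p@(∣A∣ , _) → ≤-reflexive (begin-equality
      h * weight G A                                              ≡⟨ cong (_* weight G A) ∣A∣ ⟨
      ∣ A ∣ * weight G A                                          ≡⟨ trans (cong (_* weight G A) (∣p∣≡∑ A)) (*-comm _ (weight G A)) ⟩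
      weight G A * ∑ (allFin n) (λ v → (v ∈? A) ▸ 1)              ≡⟨ ∑-*ˡ (allFin n) (weight G A) _ ⟨
      ∑ (allFin n) (λ v → weight G A * ((v ∈? A) ▸ 1))
        ≡⟨ ∑-cong (allFin n) (λ v → trans (sym (▸-*ˡ (v ∈? A) (weight G A) 1))
             (▸-cong (v ∈? A) (λ _ → trans (*-identityʳ _) (sym (▸-yes (connected? G h A) p))))) ⟩
      ∑ (allFin n) (λ v → (v ∈? A) ▸ connected? G h A ▸ weight G A) ∎))
  at : ∀ v → ∑ (subsets n) (λ A → (v ∈? A) ▸ connected? G h A ▸ weight G A) ≤ 5 ^ pred n
  at v = begin
    ∑ (subsets n) (λ A → (v ∈? A) ▸ connected? G h A ▸ weight G A)
      ≤⟨ ∑-mono (subsets n) (λ A → ▸-bound (v ∈? A) λ v∈A → ▸-mono (connected? G h A) (between? G ⁅ v ⁆ ∅ A)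
           (λ (_ , unsplittable) → unsplittable , (λ x∈ → subst (_∈ A) (sym (x∈⁅y⁆⇒x≡y v x∈)) v∈A) , ⊥⊆) (λ _ → ≤-refl)) ⟩
    ∑ (subsets n) (λ A → between? G ⁅ v ⁆ ∅ A ▸ weight G A)
      ≤⟨ percolation G (pred n) ⁅ v ⁆ ∅ (v , x∈⁅x⁆ v) ⊥⊆
           (trans (cong₂ (λ a b → a + b + pred n) (∣⁅x⁆∣≡1 v) (∣⊥∣≡0 n)) (suc-pred n {{nonempty v}})) ⟩
    4 ^ ∣ ∅ {n} ∣ * 5 ^ pred n
      ≡⟨ trans (cong (λ a → 4 ^ a * 5 ^ pred n) (∣⊥∣≡0 n)) (+-identityʳ _) ⟩
    5 ^ pred n ∎
    where
    nonempty : ∀ {n} → Fin n → NonZero n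
    nonempty zero    = _
    nonempty (suc _) = _

module _ {n N g f s M : ℕ} (g+f≡s : g + f ≡ s) (10r≤n : 10 * suc s ≤ n) (h+N≡n : suc g + N ≡ n)
         (M+4r≡N : M + 4 * suc s ≡ N) where

  private
    r h : ℕ
    r = suc s
    h = suc g

  -- Outside the window 3r < d ≤ 4r the left side is 0. Inside it, multiply by C(N, d):
  -- `trinomial-revision` replaces C(c, M) C(N, d) by C(N, M) C(4r, d), and `central-bound` remains,
  -- since n - 1 = g + d + c.
  predC-bound : ∀ d c → d + c ≡ N →
    2 * n * 5 ^ pred n * ((c C M) * predC h d (3 * r)) ≤ (N C M) * (h * (4 ^ d * 5 ^ c))
  predC-bound zero    c _ = ≤-trans (≤-reflexive (trans (cong (2 * n * 5 ^ pred n *_) (*-zeroʳ (c C M))) (*-zeroʳ (2 * n * 5 ^ pred n)))) z≤n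
  predC-bound (suc e) c d+c≡N with 3 * r ≤? e
  ... | no  ≰ = ≤-trans (≤-reflexive (trans (cong (λ z → 2 * n * 5 ^ pred n * ((c C M) * z)) (k>n⇒nCk≡0 (≰⇒> ≰)))
                  (trans (cong (2 * n * 5 ^ pred n *_) (*-zeroʳ (c C M))) (*-zeroʳ (2 * n * 5 ^ pred n))))) z≤n
  ... | yes 3r≤e = *-cancelʳ-≤ _ _ (N C d) {{>-nonZero (nCk>0 d≤N)}} (begin
    2 * n * 5 ^ pred n * ((c C M) * (e C (3 * r))) * (N C d)
      ≡⟨ shuffle₁ (2 * n * 5 ^ pred n) (c C M) (e C (3 * r)) (N C d) ⟩
    2 * n * 5 ^ pred n * (e C (3 * r)) * ((c C M) * (N C d))
      ≡⟨ cong (2 * n * 5 ^ pred n * (e C (3 * r)) *_) (trinomial-revision {N} {M} {4 * r} {c} {d} (trans (+-comm c d) d+c≡N) M+4r≡N) ⟩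
    2 * n * 5 ^ pred n * (e C (3 * r)) * ((N C M) * ((4 * r) C d))
      ≡⟨ cong (λ z → 2 * n * z * (e C (3 * r)) * ((N C M) * ((4 * r) C d))) powers ⟩
    2 * n * (5 ^ (g + d) * 5 ^ c) * (e C (3 * r)) * ((N C M) * ((4 * r) C d))
      ≡⟨ shuffle₂ (2 * n) (5 ^ (g + d)) (5 ^ c) (e C (3 * r)) (N C M) ((4 * r) C d) ⟩
    (N C M) * 5 ^ c * (2 * n * 5 ^ (g + d) * ((e C (3 * r)) * ((4 * r) C d)))
      ≤⟨ *-monoʳ-≤ ((N C M) * 5 ^ c) central ⟩
    (N C M) * 5 ^ c * (h * 4 ^ d * (N C d))
      ≡⟨ shuffle₃ (N C M) (5 ^ c) h (4 ^ d) (N C d) ⟩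
    (N C M) * (h * (4 ^ d * 5 ^ c)) * (N C d) ∎)
    where
    open ≤-Reasoning
    d = suc e
    d≤N : d ≤ N
    d≤N = subst (d ≤_) d+c≡N (m≤m+n d c)
    powers : 5 ^ pred n ≡ 5 ^ (g + d) * 5 ^ c
    powers = trans (cong (λ z → 5 ^ pred z) (sym h+N≡n))
      (trans (cong (λ z → 5 ^ (g + z)) (sym d+c≡N)) (trans (cong (5 ^_) (sym (+-assoc g d c))) (^-distribˡ-+-* 5 (g + d) c)))
    shuffle₁ : ∀ k x y z → k * (x * y) * z ≡ k * y * (x * z)
    shuffle₁ = solve-∀
    shuffle₂ : ∀ m p q x y z → m * (p * q) * x * (y * z) ≡ y * q * (m * p * (x * z))
    shuffle₂ = solve-∀
    shuffle₃ : ∀ x q h p z → x * q * (h * p * z) ≡ x * (h * (p * q)) * z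
    shuffle₃ = solve-∀
    central : 2 * n * 5 ^ (g + d) * ((e C (3 * r)) * ((4 * r) C d)) ≤ h * 4 ^ d * (N C d)
    central with d ≤? 4 * r
    ... | no  d≰ = ≤-trans (≤-reflexive (trans (cong (λ z → 2 * n * 5 ^ (g + d) * ((e C (3 * r)) * z)) (k>n⇒nCk≡0 (≰⇒> d≰)))
                     (trans (cong (2 * n * 5 ^ (g + d) *_) (*-zeroʳ (e C (3 * r)))) (*-zeroʳ (2 * n * 5 ^ (g + d)))))) z≤n
    ... | yes d≤ = central-bound n N g f s e (4 * r ∸ d) g+f≡s 10r≤n h+N≡n 3r≤e (m+[n∸m]≡n d≤)

  tail-bound : ∀ (G : Graph n) → 2 * (n * 5 ^ pred n) * tail h G M (3 * r) ≤ (N C M) * (n * 5 ^ pred n)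
  tail-bound G = begin
    2 * (n * 5 ^ pred n) * tail h G M (3 * r)
      ≡⟨ cong (_* tail h G M (3 * r)) (*-assoc 2 n (5 ^ pred n)) ⟨
    2 * n * 5 ^ pred n * tail h G M (3 * r)
      ≡⟨ total-*ˡ h G (2 * n * 5 ^ pred n) (λ d c → (c C M) * predC h d (3 * r)) ⟨
    total h G (λ d c → 2 * n * 5 ^ pred n * ((c C M) * predC h d (3 * r)))
      ≤⟨ total-mono h h+N≡n G predC-bound ⟩
    total h G (λ d c → (N C M) * (h * (4 ^ d * 5 ^ c)))
      ≡⟨ trans (total-*ˡ h G (N C M) (λ d c → h * (4 ^ d * 5 ^ c))) (cong ((N C M) *_) (total-*ˡ h G h (λ d c → 4 ^ d * 5 ^ c))) ⟩
    (N C M) * (h * total h G (λ d c → 4 ^ d * 5 ^ c))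
      ≤⟨ *-monoʳ-≤ (N C M) (weight-bound h G) ⟩
    (N C M) * (n * 5 ^ pred n) ∎
    where open ≤-Reasoning

  tail-small : ∀ (G : Graph n) → ¬ ((N C M) ≤ tail h G M (3 * r))
  tail-small G ≤tail = <⇒≱ (begin-strict
    (N C M) * K           <⟨ m<m+n _ (*-mono-≤ NCM>0 K>0) ⟩
    (N C M) * K + (N C M) * K ≡⟨ ring (N C M) K ⟩
    2 * K * (N C M)       ≤⟨ *-monoʳ-≤ (2 * K) ≤tail ⟩
    2 * K * tail h G M (3 * r) ∎) (tail-bound G)
    where
    open ≤-Reasoning
    K = n * 5 ^ pred n
    NCM>0 : 0 < N C M
    NCM>0 = nCk>0 (subst (M ≤_) M+4r≡N (m≤m+n M _))
    K>0 : 0 < K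
    K>0 = *-mono-≤ (≤-trans (s≤s z≤n) 10r≤n) (m^n>0 5 (pred n))
    ring : ∀ x k → x * k + x * k ≡ 2 * k * x
    ring = solve-∀

-- Closed sets, components and the conclusion

∈⇒∣p∣>0 : ∀ {p : Subset n} {x} → x ∈ p → 0 < ∣ p ∣
∈⇒∣p∣>0 {p = p} {x} x∈p = subst (_≤ ∣ p ∣) (∣⁅x⁆∣≡1 x)
  (p⊆q⇒∣p∣≤∣q∣ λ y∈ → subst (_∈ p) (sym (x∈⁅y⁆⇒x≡y x y∈)) x∈p)

∣p∣>0⇒Nonempty : ∀ (p : Subset n) → 0 < ∣ p ∣ → Nonempty p
∣p∣>0⇒Nonempty {n} p 0<∣p∣ with nonempty? p
... | yes nonempty = nonempty
... | no  empty    = contradiction (subst (0 <_) (trans (cong ∣_∣ (Empty-unique empty)) (∣⊥∣≡0 n)) 0<∣p∣) λ ()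

-- Such a set is a union of components.
Closed : Graph n → Subset n → Set
Closed G A = Empty (near G A)

closed-reach : ∀ (G : Graph n) {A x y} → Closed G A → x ∈ A → Reachable G x y → y ∈ A
closed-reach G closed x∈A here = x∈A
closed-reach G {A} {x} closed x∈A (step {w = w} edge path) with w ∈? A
... | yes w∈A = closed-reach G closed w∈A path
... | no  w∉A = contradiction (w , ∈-comprehension⁺ (near? G A) (w∉A , x , x∈A , edge)) closed

connected-closed : ∀ {G : Graph n} {A} → Connected G → Closed G A → Nonempty A → ∣ A ∣ ≡ n
connected-closed {n} {G} connected closed (x , x∈A) =
  trans (cong ∣_∣ (⊆-antisym ⊆⊤ λ {y} _ → closed-reach G closed x∈A (connected x y))) (∣⊤∣≡n n)

-- The set A contributes C(N, M) to `closedPart` of G′. That of G is 0, because a nonempty closed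
-- set of a connected graph has n vertices and h < n.
no-small-closed : ∀ {ℓ} {G G′ : Graph n} → 9 * n ≤ 10 * ℓ → ℓ ≤ n → SameDeck ℓ G G′ → Connected G →
  ∀ {A} → Unsplittable G′ A → Closed G′ A → Nonempty A → ∣ A ∣ + ℓ ≤ n → ⊥
no-small-closed {n} {ℓ} {G} {G′} 9n≤10ℓ ℓ≤n same connected {A} unsplittable closed nonempty h+ℓ≤n
  with ∣ A ∣ in ∣A∣ | ∈⇒∣p∣>0 (proj₂ nonempty)
-- Whichever graph has the surplus, its tail is at least C(N, M), and `tail-small` excludes this for
-- every graph.
... | suc g | _ = [ (λ e → tail-small {f = f} refl 10r≤n h+N≡n M+4r≡N G (large e)) ,
                    (λ e → tail-small {f = f} refl 10r≤n h+N≡n M+4r≡N G′ (large e)) ]′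
    (tails-alternate h h+N≡n {G} {G′} same ℓ≤n M none (3 * r) (≤-reflexive degree))
  where
  open ≤-Reasoning
  h f s r N M : ℕ
  h = suc g
  -- Thus h + f = r = n - ℓ, and r ≥ 1 comes from h ≥ 1.
  f = n ∸ (h + ℓ)
  s = g + f
  r = suc s
  N = n ∸ h
  M = N ∸ 4 * r
  r+ℓ≡n : r + ℓ ≡ n
  r+ℓ≡n = trans (ring g f ℓ) (m+[n∸m]≡n h+ℓ≤n)
    where
    ring : ∀ g f ℓ → suc (g + f) + ℓ ≡ suc g + ℓ + f
    ring = solve-∀
  10r≤n : 10 * r ≤ n
  10r≤n = +-cancelʳ-≤ (9 * n) (10 * r) n (begin
    10 * r + 9 * n  ≤⟨ +-monoʳ-≤ (10 * r) 9n≤10ℓ ⟩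
    10 * r + 10 * ℓ ≡⟨ *-distribˡ-+ 10 r ℓ ⟨
    10 * (r + ℓ)    ≡⟨ cong (10 *_) r+ℓ≡n ⟩
    n + 9 * n       ∎)
  h+N≡n : h + N ≡ n
  h+N≡n = m+[n∸m]≡n (≤-trans (m≤m+n h ℓ) h+ℓ≤n)
  4r≤N : 4 * r ≤ N
  4r≤N = +-cancelˡ-≤ h (4 * r) N (begin
    h + 4 * r  ≤⟨ +-mono-≤ (s≤s (m≤m+n g f)) (*-monoˡ-≤ r (≤ᵇ⇒≤ 4 9 tt)) ⟩
    r + 9 * r  ≤⟨ 10r≤n ⟩
    n          ≡⟨ h+N≡n ⟨
    h + N      ∎)
  M+4r≡N : M + 4 * r ≡ N
  M+4r≡N = m∸n+n≡m 4r≤N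
  degree : h + (M + 3 * r) ≡ ℓ
  degree = +-cancelʳ-≡ r _ _ (begin-equality
    h + (M + 3 * r) + r ≡⟨ ring h M r ⟩
    h + (M + 4 * r)     ≡⟨ cong (h +_) M+4r≡N ⟩
    h + N               ≡⟨ h+N≡n ⟩
    n                   ≡⟨ r+ℓ≡n ⟨
    r + ℓ               ≡⟨ +-comm r ℓ ⟩
    ℓ + r               ∎)
    where
    ring : ∀ h m r → h + (m + 3 * r) + r ≡ h + (m + 4 * r)
    ring = solve-∀
  h<n : h < n
  h<n = begin
    suc h       ≡⟨ +-comm 1 h ⟩
    h + 1       ≤⟨ +-monoʳ-≤ h (≤-trans (s≤s z≤n) 4r≤N) ⟩
    h + N       ≡⟨ h+N≡n ⟩
    n           ∎
  none : closedPart h G M ≡ 0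
  none = ∑-zero (subsets n) λ B → trans
    (▸-cong (connected? G h B) λ (∣B∣ , _) → ▸-no (∣ near G B ∣ ≟ 0) λ near≡0 →
      <⇒≢ h<n (trans (sym ∣B∣) (connected-closed connected (λ (v , v∈) → <⇒≢ (∈⇒∣p∣>0 v∈) (sym near≡0))
        (∣p∣>0⇒Nonempty B (subst (0 <_) (sym ∣B∣) (s≤s z≤n))))))
    (▸-zero (connected? G h B))
    where
    ▸-zero : ∀ {P : Set} (P? : Dec P) → P? ▸ 0 ≡ 0
    ▸-zero (yes _) = refl
    ▸-zero (no _)  = refl
  near≡0 : ∣ near G′ A ∣ ≡ 0
  near≡0 = trans (cong ∣_∣ (Empty-unique closed)) (∣⊥∣≡0 n)
  present : (N C M) ≤ closedPart h G′ M
  present = begin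
    N C M                                           ≡⟨ cong (_C M) (trans (sym (near+far h h+N≡n G′ ∣A∣)) (cong (_+ ∣ far G′ A ∣) near≡0)) ⟩
    ∣ far G′ A ∣ C M                                ≡⟨ ▸-yes (∣ near G′ A ∣ ≟ 0) near≡0 ⟨
    (∣ near G′ A ∣ ≟ 0) ▸ (∣ far G′ A ∣ C M)         ≡⟨ ▸-yes (connected? G′ h A) (∣A∣ , unsplittable) ⟨
    connected? G′ h A ▸ (∣ near G′ A ∣ ≟ 0) ▸ (∣ far G′ A ∣ C M)
      ≤⟨ ∑-member (λ B → connected? G′ h B ▸ (∣ near G′ B ∣ ≟ 0) ▸ (∣ far G′ B ∣ C M)) (∈-subsets A) ⟩
    closedPart h G′ M                               ∎
  large : ∀ {x y} → x ≡ y + closedPart h G′ M → (N C M) ≤ x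
  large {y = y} refl = ≤-trans present (m≤n+m _ y)

-- Joins the connectedness of sets used in counting to the paths in `Connected`; both survive the
-- addition of a neighbour.
Piece : Graph n → Fin n → Subset n → Set
Piece G u A = Unsplittable G A × u ∈ A × (∀ {v} → v ∈ A → Reachable G u v)

Reachable-snoc : ∀ {G : Graph n} {u v w} → Reachable G u v → adj G v w ≡ true → Reachable G u w
Reachable-snoc here           edge = step edge here
Reachable-snoc (step e path) edge = step e (Reachable-snoc path edge)

singleton-piece : ∀ (G : Graph n) u → Piece G u ⁅ u ⁆
singleton-piece G u =
  (λ (U , U⊆ , (x , x∈U) , (y , y∈ , y∉U) , _) →
    y∉U (subst (_∈ U) (trans (x∈⁅y⁆⇒x≡y u (U⊆ x∈U)) (sym (x∈⁅y⁆⇒x≡y u y∈))) x∈U)) ,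
  x∈⁅x⁆ u , λ v∈ → subst (Reachable G u) (sym (x∈⁅y⁆⇒x≡y u v∈)) here

-- The edge from x to w keeps both on the same side of any split U, so U ∩ A still splits A: if w is
-- the only witness on its side within the larger set, x replaces it.
extend-piece : ∀ (G : Graph n) {u A w} → Piece G u A → w ∈ near G A → Piece G u (A ∪ ⁅ w ⁆)
extend-piece G {u} {A} {w} (unsplittable , u∈A , reach) w∈near
  with w∉A , x , x∈A , edge ← ∈-comprehension⁻ (near? G A) w∈near =
  unsplittable′ , x∈p∪q⁺ (inj₁ u∈A) , reach′
  where
  reach′ : ∀ {v} → v ∈ A ∪ ⁅ w ⁆ → Reachable G u v
  reach′ v∈ with x∈p∪q⁻ A ⁅ w ⁆ v∈
  ... | inj₁ v∈A  = reach v∈A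
  ... | inj₂ v∈⁅w⁆ = subst (Reachable G u) (sym (x∈⁅y⁆⇒x≡y w v∈⁅w⁆)) (Reachable-snoc (reach x∈A) edge)
  unsplittable′ : Unsplittable G (A ∪ ⁅ w ⁆)
  unsplittable′ (U , U⊆ , (a , a∈U) , (b , b∈ , b∉U) , uncrossed) =
    unsplittable (U ∩ A , p∩q⊆q U A , meets , misses , λ p q p∈ q∈A q∉ →
      uncrossed p q (proj₁ (x∈p∩q⁻ U A p∈)) (x∈p∪q⁺ (inj₁ q∈A)) (λ q∈U → q∉ (x∈p∩q⁺ (q∈U , q∈A))))
    where
    w∈ : w ∈ A ∪ ⁅ w ⁆
    w∈ = x∈p∪q⁺ (inj₂ (x∈⁅x⁆ w))
    x∈U⇒w∈U : x ∈ U → w ∈ U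
    x∈U⇒w∈U x∈U with w ∈? U
    ... | yes w∈U = w∈U
    ... | no  w∉U = contradiction (trans (sym edge) (uncrossed x w x∈U w∈ w∉U)) λ ()
    w∈U⇒x∈U : w ∈ U → x ∈ U
    w∈U⇒x∈U w∈U with x ∈? U
    ... | yes x∈U = x∈U
    ... | no  x∉U = contradiction (trans (sym edge)
          (trans (adj-sym G x w) (uncrossed w x w∈U (x∈p∪q⁺ (inj₁ x∈A)) x∉U))) λ ()
    meets : Nonempty (U ∩ A)
    meets with x∈p∪q⁻ A ⁅ w ⁆ (U⊆ a∈U)
    ... | inj₁ a∈A   = a , x∈p∩q⁺ (a∈U , a∈A)
    ... | inj₂ a∈⁅w⁆ = x , x∈p∩q⁺ (w∈U⇒x∈U (subst (_∈ U) (x∈⁅y⁆⇒x≡y w a∈⁅w⁆) a∈U) , x∈A)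
    misses : ∃ λ y → y ∈ A × y ∉ U ∩ A
    misses with x∈p∪q⁻ A ⁅ w ⁆ b∈
    ... | inj₁ b∈A   = b , b∈A , λ b∈ → b∉U (proj₁ (x∈p∩q⁻ U A b∈))
    ... | inj₂ b∈⁅w⁆ = x , x∈A , λ x∈ → b∉U (subst (_∈ U) (sym (x∈⁅y⁆⇒x≡y w b∈⁅w⁆)) (x∈U⇒w∈U (proj₁ (x∈p∩q⁻ U A x∈))))

-- Neighbours are added one at a time until the size is reached or none is left. With k = n only the
-- second outcome is possible and gives a component; in a connected graph the first gives a
-- connected card.
grow : ∀ (G : Graph n) u k →
  (∃ λ A → Piece G u A × ∣ A ∣ ≡ suc k) ⊎ (∃ λ A → Piece G u A × Closed G A × ∣ A ∣ ≤ k)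
grow G u zero    = inj₁ (⁅ u ⁆ , singleton-piece G u , ∣⁅x⁆∣≡1 u)
grow G u (suc k) with grow G u k
... | inj₂ (A , piece , closed , ∣A∣≤k) = inj₂ (A , piece , closed , m≤n⇒m≤1+n ∣A∣≤k)
... | inj₁ (A , piece , ∣A∣) with nonempty? (near G A)
...   | no  closed       = inj₂ (A , piece , closed , ≤-reflexive ∣A∣)
...   | yes (w , w∈near) = inj₁ (A ∪ ⁅ w ⁆ , extend-piece G piece w∈near ,
          trans (∣p∪⁅x⁆∣≡1+∣p∣ A (proj₁ (∈-comprehension⁻ (near? G A) w∈near))) (cong suc ∣A∣))

component : ∀ (G : Graph n) u → ∃ λ A → Piece G u A × Closed G A
component {n} G u with grow G u n
... | inj₁ (A , _ , ∣A∣)        = contradiction (subst (_≤ n) ∣A∣ (∣p∣≤n A)) 1+n≰n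
... | inj₂ (A , piece , closed , _) = A , piece , closed

connected-card : ∀ {G : Graph n} → Connected G → Fin n → ∀ k → suc k ≤ n →
  ∃ λ S → Unsplittable G S × ∣ S ∣ ≡ suc k
connected-card {G = G} connected u k k<n with grow G u k
... | inj₁ (S , (unsplittable , _) , ∣S∣) = S , unsplittable , ∣S∣
... | inj₂ (S , (_ , u∈S , _) , closed , ∣S∣≤k) =
  contradiction (≤-trans k<n (≤-trans (≤-reflexive (sym (connected-closed connected closed (u , u∈S)))) ∣S∣≤k)) 1+n≰n

-- Otherwise A ∩ B would split B, since no edge leaves A.
unsplittable-inside : ∀ {G : Graph n} {A B x} → Closed G A → Unsplittable G B → x ∈ A → x ∈ B → B ⊆ A
unsplittable-inside {G = G} {A} {B} {x} closed unsplittable x∈A x∈B {y} y∈B with y ∈? A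
... | yes y∈A = y∈A
... | no  y∉A = ⊥-elim (unsplittable (A ∩ B , p∩q⊆q A B , (x , x∈p∩q⁺ (x∈A , x∈B)) ,
        (y , y∈B , λ y∈ → y∉A (proj₁ (x∈p∩q⁻ A B y∈))) , λ p q p∈ q∈B q∉ → ¬-not λ edge →
          closed (q , ∈-comprehension⁺ (near? G A) ((λ q∈A → q∉ (x∈p∩q⁺ (q∈A , q∈B))) , p , proj₁ (x∈p∩q⁻ A B p∈) , edge))))

disjoint-size : ∀ (p q : Subset n) → (∀ {x} → x ∈ p → x ∉ q) → ∣ p ∣ + ∣ q ∣ ≤ n
disjoint-size {n} p q disjoint = subst (_≤ n) (∣p∪q∣≡∣p∣+∣q∣ p q disjoint) (∣p∣≤n (p ∪ q))

connected-transfer : ∀ {ℓ} {G G′ : Graph n} →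
  3 ≤ n → 9 * n ≤ 10 * ℓ → ℓ ≤ n → SameDeck ℓ G G′ → Connected G → Connected G′
connected-transfer {ℓ = zero} 3≤n 9n≤0 = contradiction (≤-trans (*-mono-≤ {1} {9} (s≤s z≤n) (≤-trans (s≤s z≤n) 3≤n)) 9n≤0) λ ()
connected-transfer {n} {suc k} {G} {G′} 3≤n 9n≤10ℓ ℓ≤n same@(σ , isos) connected u v
  with S , S-unsplittable , ∣S∣ ← connected-card {G = G} connected u k ℓ≤n
  with A , (A-unsplittable , u∈A , A-reach) , A-closed ← component G′ u
  with B , (B-unsplittable , v∈B , _) , B-closed ← component G′ v
  with v ∈? A
... | yes v∈A = A-reach v∈A
... | no  v∉A = ⊥-elim (separate (nonempty? (A ∩ T)))
  where
  T : Subset n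
  T = proj₁ (Bijection.to σ (S , ∣S∣))
  ∣T∣ : ∣ T ∣ ≡ suc k
  ∣T∣ = proj₂ (Bijection.to σ (S , ∣S∣))
  T-unsplittable : Unsplittable G′ T
  T-unsplittable = let (φ , iso) = isoOn {G = G} {G′} (isos (S , ∣S∣)) in
    subst (Unsplittable G′) (Image.image-onto iso) (Image.image-unsplittable iso (λ x∈S → x∈S) S-unsplittable)
  too-small : ∀ {D : Subset n} {x} → Unsplittable G′ D → Closed G′ D → x ∈ D → (∀ {y} → y ∈ D → y ∉ T) → ⊥
  too-small {D} {x} unsplittable closed x∈C disjoint =
    no-small-closed {G = G} {G′} 9n≤10ℓ ℓ≤n same connected unsplittable closed (x , x∈C)
      (subst (λ t → ∣ D ∣ + t ≤ n) ∣T∣ (disjoint-size D T disjoint))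
  separate : Dec (Nonempty (A ∩ T)) → ⊥
  separate (no  apart)    = too-small A-unsplittable A-closed u∈A λ y∈A y∈T → apart (_ , x∈p∩q⁺ (y∈A , y∈T))
  -- Here T meets A and so lies inside A. A vertex common to B and T would then pull B, and with it
  -- v, into A; so B misses T.
  separate (yes (z , z∈)) = too-small B-unsplittable B-closed v∈B λ y∈B y∈T →
    v∉A (unsplittable-inside {G = G′} A-closed B-unsplittable
      (unsplittable-inside {G = G′} A-closed T-unsplittable (proj₁ (x∈p∩q⁻ A T z∈)) (proj₂ (x∈p∩q⁻ A T z∈)) y∈T) y∈B v∈B)

theorem1p5 : (n ℓ : ℕ) → 3 ≤ n → 9 * n ≤ 10 * ℓ → ℓ ≤ n →
    (G G' : Graph n) → SameDeck ℓ G G' → (Connected G ⇔ Connected G')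
theorem1p5 n ℓ 3≤n 9n≤10ℓ ℓ≤n G G' same =
  mk⇔ (connected-transfer {G = G} {G'} 3≤n 9n≤10ℓ ℓ≤n same)
      (connected-transfer {G = G'} {G} 3≤n 9n≤10ℓ ℓ≤n (SameDeck-sym {G = G} {G'} same))
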